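{- Let $n \geq 1$ and let $x_1,\dots,x_n$, $y_1,\dots,y_n$ and $t$ be indeterminates. Then $$ \sum_{\lambda} \prod_{i=1}^{n} \left(1-t^{\lambda_i-i+n+1}\right) s_{\lambda}(x_1,\dots,x_n)\, s_{\lambda}(y_1,\dots,y_n) = \frac{1}{\prod_{1\leq i<j\leq n}(x_i-x_j)\ \prod_{1\leq i<j\leq n}(y_i-y_j)} \det\left[\frac{(1-t)}{(1-x_i y_j)(1-t x_i y_j)}\right]_{1\leq i,j\leq n}, $$ where the sum is over all partitions $\lambda=(\lambda_1\geq\cdots\geq\lambda_n\geq 0)$ with at most $n$ non-zero parts.
   Context: A partition is a finite weakly decreasing sequence of positive integers (possibly empty); a partition with at most $n$ parts is padded with zeros so that $\lambda_1,\dots,\lambda_n$ are all defined. The Schur polynomial of a partition $\lambda$ with at most $n$ parts is $$ s_{\lambda}(x_1,\dots,x_n)=\frac{\det\left[x_i^{\lambda_j-j+n}\right]_{1\leq i,j\leq n}}{\prod_{1\leq i<j\leq n}(x_i-x_j)} . $$ The identity is understood as one of formal power series in $x_1,\dots,x_n,y_1,\dots,y_n$ with coefficients polynomial in $t$, the entries of the determinant being expanded as geometric series in the variables $x_i y_j$. -}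

module Defs where

open import Algebra.Bundles using (CommutativeMonoid; CommutativeRing; RawRing)
open import Algebra.Structures using (IsCommutativeRing)
open import Algebra.Morphism.Structures using (IsRingMonomorphism)
import Algebra.Morphism.RingMonomorphism as RingMonomorphism
import Algebra.Properties.CommutativeMonoid.Sum as MonoidSum
import Algebra.Properties.CommutativeSemigroup as CommutativeSemigroupProperties
import Algebra.Properties.Ring as RingProperties
import Algebra.Properties.Semiring.Exp as Exp
import Algebra.Properties.Semiring.Sum as Sum
open import Data.Bool.Base using (true; false; T; if_then_else_)
open import Data.Empty using (⊥-elim)
open import Data.Fin.Base using (Fin; zero; suc; toℕ; punchIn; _↑ˡ_; _↑ʳ_)
open import Data.Fin.Properties using (_<?_; <⇒≢; toℕ≤pred[n]; ↑ˡ-injective; ↑ʳ-injective)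
import Data.Integer.Properties as ℤ
open import Data.List.Base using (List; []; _∷_; map; foldr)
open import Data.List.Relation.Binary.Subset.Propositional using (_⊆_)
open import Data.List.Relation.Unary.Unique.Propositional using (Unique)
open import Data.Nat.Base as ℕ using (ℕ; zero; suc; z≤n; s≤s; _∸_; _≤_; _<_; _≥_)
import Data.Nat.Properties as ℕ
open import Data.Product.Base using (Σ-syntax; ∃-syntax; _,_; proj₁; proj₂)
open import Data.Unit.Base using (tt)
open import Data.Sum.Base using (_⊎_; inj₁; inj₂)
open import Data.Vec.Base as Vec using (Vec; []; _∷_; lookup)
open import Data.Vec.Relation.Unary.Linked using (Linked)
open import Function.Base using (_∘_; _$_)
open import Level using (0ℓ; _⊔_)
open import Relation.Binary.PropositionalEquality as ≡ using (_≡_; _≢_; _≗_)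
import Relation.Binary.Reasoning.Setoid as SetoidReasoning
open import Relation.Nullary.Decidable using (does)

-- A partition with at most n parts, padded with zeros to length n.
-- The irrelevant field makes _≡_ compare only the parts.

record Partition (n : ℕ) : Set where
  constructor partition
  field
    parts       : Vec ℕ n
    .decreasing : Linked _≥_ parts

-- μⱼ - j + n for j counted from 1; here j counts from 0.

exponent : ∀ {n} → Partition n → Fin n → ℕ
exponent {n} μ j = lookup (Partition.parts μ) j ℕ.+ (n ∸ suc (toℕ j))

module RingTheory {c ℓ} (A : CommutativeRing c ℓ) where

  open CommutativeRing A public hiding (zero)
  open RingProperties ring public
    using (-‿distribˡ-*; -‿distribʳ-*; -‿involutive; -0#≈0#; -‿+-comm; [y-z]x≈yx-zx)
  open Sum semiring public
  open Exp semiring public using (_^_)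
  open SetoidReasoning setoid
  private
    module * = CommutativeSemigroupProperties *-commutativeSemigroup

  infixl 10 ∏-syntax

  ∏-syntax : ∀ n → (Fin n → Carrier) → Carrier
  ∏-syntax _ = MonoidSum.sum *-commutativeMonoid

  syntax ∏-syntax n (λ i → a) = ∏[ i < n ] a

  sign : ∀ {n} → Fin n → Carrier
  sign j = (- 1#) ^ toℕ j

  det : ∀ {n} → (Fin n → Fin n → Carrier) → Carrier
  det {zero}  M = 1#
  det {suc n} M = ∑[ j ≤ n ] (sign j * M zero j * det (λ i k → M (suc i) (punchIn j k)))

  Δ : ∀ {n} → (Fin n → Carrier) → Carrier
  Δ {n} v = ∏[ i < n ] ∏[ j < n ] (if does (i <? j) then v i - v j else 1#)

  Regular : Carrier → Set (c ⊔ ℓ)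
  Regular g = ∀ q → q * g ≈ 0# → q ≈ 0#

  -- The fraction f / g, as an element of A. For regular g it is the only
  -- q with q / 1 = f / g in the total ring of fractions.

  record Quotient (f g : Carrier) : Set (c ⊔ ℓ) where
    field
      value  : Carrier
      exact  : value * g ≈ f
      unique : ∀ q → q * g ≈ f → q ≈ value

  a+b-b≈a : ∀ a b → (a + b) - b ≈ a
  a+b-b≈a a b = begin
    (a + b) - b    ≈⟨ +-assoc _ _ _ ⟩
    a + (b - b)    ≈⟨ +-congˡ (-‿inverseʳ b) ⟩
    a + 0#         ≈⟨ +-identityʳ a ⟩
    a              ∎

  a-b+b≈a : ∀ a b → (a - b) + b ≈ a
  a-b+b≈a a b = begin
    (a - b) + b    ≈⟨ +-assoc _ _ _ ⟩
    a + (- b + b)  ≈⟨ +-congˡ (-‿inverseˡ b) ⟩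
    a + 0#         ≈⟨ +-identityʳ a ⟩
    a              ∎

  a-b≈0⇒a≈b : ∀ {a b} → a - b ≈ 0# → a ≈ b
  a-b≈0⇒a≈b {a} {b} a-b≈0 = begin
    a            ≈⟨ a-b+b≈a a b ⟨
    (a - b) + b  ≈⟨ +-congʳ a-b≈0 ⟩
    0# + b       ≈⟨ +-identityˡ b ⟩
    b            ∎

  quotient : ∀ {f g} → Regular g → Σ[ q ∈ Carrier ] q * g ≈ f → Quotient f g
  quotient {f} {g} reg (q , qg≈f) = record
    { value  = q
    ; exact  = qg≈f
    ; unique = λ q′ q′g≈f → a-b≈0⇒a≈b $ reg (q′ - q) $ begin
        (q′ - q) * g    ≈⟨ [y-z]x≈yx-zx g q′ q ⟩
        q′ * g - q * g  ≈⟨ +-cong q′g≈f (-‿cong qg≈f) ⟩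
        f - f           ≈⟨ -‿inverseʳ f ⟩
        0#              ∎
    }

  regular-* : ∀ {g h} → Regular g → Regular h → Regular (g * h)
  regular-* reg-g reg-h q q*gh≈0 =
    reg-g q $ reg-h _ $ trans (*-assoc _ _ _) q*gh≈0

  regular-1 : Regular 1#
  regular-1 q q*1≈0 = trans (sym (*-identityʳ q)) q*1≈0

  regular-resp : ∀ {g h} → g ≈ h → Regular g → Regular h
  regular-resp g≈h reg q q*h≈0 = reg q (trans (*-congˡ g≈h) q*h≈0)

  regular-neg : ∀ {g} → Regular g → Regular (- g)
  regular-neg {g} reg q q*-g≈0 = reg q $ begin
    q * g        ≈⟨ -‿involutive _ ⟨
    - - (q * g)  ≈⟨ -‿cong (-‿distribʳ-* q g) ⟩
    - (q * - g)  ≈⟨ -‿cong q*-g≈0 ⟩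
    - 0#         ≈⟨ -0#≈0# ⟩
    0#           ∎

  regular-∏ : ∀ {n} (f : Fin n → Carrier) → (∀ i → Regular (f i)) → Regular (∏[ i < n ] f i)
  regular-∏ {zero}  f reg = regular-1
  regular-∏ {suc n} f reg = regular-* (reg zero) (regular-∏ (f ∘ suc) (reg ∘ suc))

  sum-cong : ∀ n {f g : Fin n → Carrier} → (∀ i → f i ≈ g i) → sum f ≈ sum g
  sum-cong _ = sum-cong-≋

  sum-0 : ∀ n {f : Fin n → Carrier} → (∀ i → f i ≈ 0#) → sum f ≈ 0#
  sum-0 n f≈0 = trans (sum-cong n f≈0) (sum-replicate-zero n)

  ∏-cong : ∀ n {f g : Fin n → Carrier} → (∀ i → f i ≈ g i) → ∏[ i < n ] f i ≈ ∏[ i < n ] g i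
  ∏-cong _ = MonoidSum.sum-cong-≋ *-commutativeMonoid

  det-cong : ∀ {n} {M N : Fin n → Fin n → Carrier} → (∀ i j → M i j ≈ N i j) → det M ≈ det N
  det-cong {zero}  M≈N = refl
  det-cong {suc n} M≈N = sum-cong (suc n) λ j →
    *-cong (*-congˡ {x = sign j} (M≈N zero j)) (det-cong λ i k → M≈N (suc i) (punchIn j k))

  Δ-suc : ∀ {n} (v : Fin (suc n) → Carrier) →
          Δ v ≈ (∏[ i < n ] (v zero - v (suc i))) * Δ (v ∘ suc)
  Δ-suc {n} v = *-cong (*-identityˡ _) (∏-cong n λ i → *-identityˡ _)

  -- Δ v divides every determinant det [pⱼ(vᵢ)] with polynomial columns:
  -- subtract the first row from the others, take out the factors
  -- v₀ - vᵢ, and expand along the first row.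

  module RowReduction where

    dbl : ∀ {n} (u v : Fin (2 ℕ.+ n) → Carrier) → ((Fin n → Fin (2 ℕ.+ n)) → Carrier) → Carrier
    dbl {n} u v E =
      ∑[ j ≤ suc n ] (sign j * u j *
        ∑[ l ≤ n ] (sign l * v (punchIn j l) * E (λ k → punchIn j (punchIn l k))))

    Extensional : ∀ {m n} → ((Fin m → Fin n) → Carrier) → Set ℓ
    Extensional E = ∀ {f g} → f ≗ g → E f ≈ E g

    dbl′ : ∀ {n} (u v : Fin (2 ℕ.+ n) → Carrier) → ((Fin n → Fin (2 ℕ.+ n)) → Carrier) → Carrier
    dbl′ {n} u v E =
      ∑[ j ≤ n ] (sign j * u (suc j) *
        ∑[ l < n ] (sign l * v (suc (punchIn j l)) *
          E (λ k → punchIn (suc j) (punchIn (suc l) k))))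

    top : ∀ {n} → (Fin (2 ℕ.+ n) → Carrier) → ((Fin n → Fin (2 ℕ.+ n)) → Carrier) → Carrier
    top {n} v E = ∑[ l ≤ n ] (sign l * v (suc l) * E (λ k → suc (punchIn l k)))

    lift : ∀ {m n} → (Fin m → Fin n) → Fin (suc m) → Fin (suc n)
    lift f zero    = zero
    lift f (suc k) = suc (f k)

    neg-sign : ∀ {n} (s : Fin n) a b → - 1# * sign s * a * b ≈ - (sign s * a * b)
    neg-sign s a b = begin
      - 1# * sign s * a * b    ≈⟨ *-congʳ (*-congʳ (-‿distribˡ-* 1# (sign s))) ⟨
      - (1# * sign s) * a * b  ≈⟨ *-congʳ (*-congʳ (-‿cong (*-identityˡ _))) ⟩
      - sign s * a * b         ≈⟨ *-congʳ (-‿distribˡ-* _ _) ⟨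
      - (sign s * a) * b       ≈⟨ -‿distribˡ-* _ _ ⟨
      - (sign s * a * b)       ∎

    sum-neg : ∀ n (f : Fin n → Carrier) → ∑[ i < n ] (- f i) ≈ - ∑[ i < n ] f i
    sum-neg zero    f = sym -0#≈0#
    sum-neg (suc n) f = trans (+-congˡ (sum-neg n (f ∘ suc))) (-‿+-comm _ _)

    dbl-decompose : ∀ {n} (u v : Fin (2 ℕ.+ n) → Carrier) E →
      dbl u v E ≈ (u zero * top v E - v zero * top u E) + dbl′ u v E
    dbl-decompose {n} u v E = begin
      dbl u v E
        ≈⟨ +-cong (*-congʳ (*-identityˡ _)) (begin
             ∑[ j ≤ n ] (- 1# * sign j * u (suc j) * (1# * v zero * D j + I′ j))
               ≈⟨ sum-cong (suc n) rowStep ⟩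
             ∑[ j ≤ n ] (- (v zero * (sign j * u (suc j) * D j)) + sign j * u (suc j) * I j)
               ≈⟨ ∑-distrib-+ (λ j → - (v zero * (sign j * u (suc j) * D j)))
                              (λ j → sign j * u (suc j) * I j) ⟩
             ∑[ j ≤ n ] (- (v zero * (sign j * u (suc j) * D j))) + dbl′ u v E
               ≈⟨ +-congʳ (sum-neg (suc n) (λ j → v zero * (sign j * u (suc j) * D j))) ⟩
             - ∑[ j ≤ n ] (v zero * (sign j * u (suc j) * D j)) + dbl′ u v E
               ≈⟨ +-congʳ (-‿cong (*-distribˡ-sum (v zero) (λ j → sign j * u (suc j) * D j))) ⟨
             - (v zero * top u E) + dbl′ u v E ∎) ⟩
      u zero * top v E + (- (v zero * top u E) + dbl′ u v E)
        ≈⟨ +-assoc _ _ _ ⟨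
      (u zero * top v E - v zero * top u E) + dbl′ u v E ∎
      where
      D : Fin (suc n) → Carrier
      D j = E (λ k → suc (punchIn j k))
      term : Fin (suc n) → Fin n → Carrier
      term j l = v (suc (punchIn j l))
      minorE : Fin (suc n) → Fin n → Carrier
      minorE j l = E (λ k → punchIn (suc j) (punchIn (suc l) k))
      I I′ : Fin (suc n) → Carrier
      I  j = ∑[ l < n ] (sign l * term j l * minorE j l)
      I′ j = ∑[ l < n ] (- 1# * sign l * term j l * minorE j l)
      rowStep : ∀ j → - 1# * sign j * u (suc j) * (1# * v zero * D j + I′ j) ≈
                      - (v zero * (sign j * u (suc j) * D j)) + sign j * u (suc j) * I j
      rowStep j = begin
        - 1# * sign j * u (suc j) * (1# * v zero * D j + I′ j)
          ≈⟨ neg-sign j (u (suc j)) _ ⟩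
        - (s * (1# * v zero * D j + I′ j))
          ≈⟨ -‿cong (*-congˡ (+-cong (*-congʳ (*-identityˡ _))
               (trans (sum-cong n λ l → neg-sign l (term j l) (minorE j l))
                      (sum-neg n (λ l → sign l * term j l * minorE j l))))) ⟩
        - (s * (v zero * D j - I j))
          ≈⟨ -‿cong (distribˡ _ _ _) ⟩
        - (s * (v zero * D j) + s * - I j)
          ≈⟨ -‿+-comm _ _ ⟨
        - (s * (v zero * D j)) + - (s * - I j)
          ≈⟨ +-cong (-‿cong (*.x∙yz≈y∙xz _ _ _)) (-‿cong (sym (-‿distribʳ-* _ _))) ⟩
        - (v zero * (s * D j)) + - - (s * I j)
          ≈⟨ +-congˡ (-‿involutive _) ⟩
        - (v zero * (s * D j)) + s * I j ∎
        where s = sign j * u (suc j)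

    dbl′-suc : ∀ {n} (u v : Fin (3 ℕ.+ n) → Carrier) E → Extensional E →
      dbl′ u v E ≈ dbl (u ∘ suc) (v ∘ suc) (E ∘ lift)
    dbl′-suc {n} u v E ext =
      sum-cong (2 ℕ.+ n) λ j → *-congˡ {x = sign j * u (suc j)} $
      sum-cong (suc n) λ l → *-congˡ {x = sign l * v (suc (punchIn j l))} $
      ext {λ k → punchIn (suc j) (punchIn (suc l) k)} {lift (λ k → punchIn j (punchIn l k))} λ { zero → ≡.refl ; (suc k) → ≡.refl }

    dbl′-zero : ∀ (u v : Fin 2 → Carrier) E → dbl′ u v E ≈ 0#
    dbl′-zero u v E = sum-0 1 λ j → zeroʳ (sign j * u (suc j))

    ext-lift : ∀ {m n} {E : (Fin (suc m) → Fin (suc n)) → Carrier} → Extensional E → Extensional (E ∘ lift)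
    ext-lift ext f≗g = ext λ { zero → ≡.refl ; (suc k) → ≡.cong suc (f≗g k) }

    dbl-self : ∀ {n} (u : Fin (2 ℕ.+ n) → Carrier) E → Extensional E → dbl u u E ≈ 0#
    dbl-self {n} u E ext = begin
      dbl u u E                                          ≈⟨ dbl-decompose u u E ⟩
      (u zero * top u E - u zero * top u E) + dbl′ u u E ≈⟨ +-cong (-‿inverseʳ _) (rest n u E ext) ⟩
      0# + 0#                                            ≈⟨ +-identityˡ _ ⟩
      0#                                                 ∎
      where
      rest : ∀ n (u : Fin (2 ℕ.+ n) → Carrier) E → Extensional E → dbl′ u u E ≈ 0#
      rest zero    u E ext = dbl′-zero u u E
      rest (suc n) u E ext = trans (dbl′-suc u u E ext) (dbl-self (u ∘ suc) (E ∘ lift) (ext-lift ext))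

    dbl-swap : ∀ {n} (u v : Fin (2 ℕ.+ n) → Carrier) E → Extensional E → dbl u v E ≈ - dbl v u E
    dbl-swap {n} u v E ext = begin
      dbl u v E
        ≈⟨ dbl-decompose u v E ⟩
      (u zero * top v E - v zero * top u E) + dbl′ u v E
        ≈⟨ +-cong (sym flip) (rest n u v E ext) ⟩
      - (v zero * top u E - u zero * top v E) + - dbl′ v u E
        ≈⟨ -‿+-comm _ _ ⟩
      - ((v zero * top u E - u zero * top v E) + dbl′ v u E)
        ≈⟨ -‿cong (dbl-decompose v u E) ⟨
      - dbl v u E ∎
      where
      flip : - (v zero * top u E - u zero * top v E) ≈ u zero * top v E - v zero * top u E
      flip = begin
        - (v zero * top u E - u zero * top v E)       ≈⟨ -‿+-comm _ _ ⟨
        - (v zero * top u E) + - - (u zero * top v E) ≈⟨ +-congˡ (-‿involutive _) ⟩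
        - (v zero * top u E) + u zero * top v E       ≈⟨ +-comm _ _ ⟩
        u zero * top v E - v zero * top u E           ∎
      rest : ∀ n (u v : Fin (2 ℕ.+ n) → Carrier) E → Extensional E → dbl′ u v E ≈ - dbl′ v u E
      rest zero    u v E ext = begin
        dbl′ u v E    ≈⟨ dbl′-zero u v E ⟩
        0#            ≈⟨ -0#≈0# ⟨
        - 0#          ≈⟨ -‿cong (dbl′-zero v u E) ⟨
        - dbl′ v u E  ∎
      rest (suc n) u v E ext = begin
        dbl′ u v E                              ≈⟨ dbl′-suc u v E ext ⟩
        dbl (u ∘ suc) (v ∘ suc) (E ∘ lift)      ≈⟨ dbl-swap (u ∘ suc) (v ∘ suc) (E ∘ lift) (ext-lift ext) ⟩
        - dbl (v ∘ suc) (u ∘ suc) (E ∘ lift)    ≈⟨ -‿cong (dbl′-suc v u E ext) ⟨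
        - dbl′ v u E                            ∎

    bordered : ∀ {n} → (Fin (suc n) → Carrier) → (Fin n → Fin (suc n) → Carrier) → Carrier
    bordered {n} u N = ∑[ j ≤ n ] (sign j * u j * det (λ i k → N i (punchIn j k)))

    minors : ∀ {n} → (Fin (suc n) → Fin (2 ℕ.+ n) → Carrier) → (Fin n → Fin (2 ℕ.+ n)) → Carrier
    minors N f = det (λ i k → N (suc i) (f k))

    minors-ext : ∀ {n} (N : Fin (suc n) → Fin (2 ℕ.+ n) → Carrier) → Extensional (minors N)
    minors-ext N f≗g = det-cong λ i k → reflexive (≡.cong (N (suc i)) (f≗g k))

    reduce : ∀ {n} (u : Fin (suc n) → Carrier) (a : Fin n → Carrier) (N W : Fin n → Fin (suc n) → Carrier) →
             (∀ i k → N i k ≈ u k + a i * W i k) →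
             bordered u N ≈ (∏[ i < n ] a i) * bordered u W
    reduce {zero}  u a N W N≈ = sym (*-identityˡ _)
    reduce {suc n} u a N W N≈ = begin
      bordered u N
        ≈⟨ dbl-swap u (N zero) (minors N) (minors-ext N) ⟩
      - dbl (N zero) u (minors N)
        ≈⟨ -‿cong (sum-cong (2 ℕ.+ n) rowStep) ⟩
      - ∑[ j ≤ suc n ] (P * (s j * B j) + P * (a zero * (t j * B j)))
        ≈⟨ -‿cong (∑-distrib-+ (λ j → P * (s j * B j)) (λ j → P * (a zero * (t j * B j)))) ⟩
      - (∑[ j ≤ suc n ] (P * (s j * B j)) + ∑[ j ≤ suc n ] (P * (a zero * (t j * B j))))
        ≈⟨ -‿cong (+-cong (*-distribˡ-sum P (λ j → s j * B j))
                          (*-distribˡ-sum P (λ j → a zero * (t j * B j)))) ⟨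
      - (P * dbl u u (minors W) + P * ∑[ j ≤ suc n ] (a zero * (t j * B j)))
        ≈⟨ -‿cong (+-cong (*-congˡ (dbl-self u (minors W) (minors-ext W)))
                          (*-congˡ (sym (*-distribˡ-sum (a zero) (λ j → t j * B j))))) ⟩
      - (P * 0# + P * (a zero * dbl (W zero) u (minors W)))
        ≈⟨ -‿cong (trans (+-congʳ (zeroʳ P)) (+-identityˡ _)) ⟩
      - (P * (a zero * dbl (W zero) u (minors W)))
        ≈⟨ -‿cong (trans (*.x∙yz≈y∙xz _ _ _) (sym (*-assoc _ _ _))) ⟩
      - (a zero * P * dbl (W zero) u (minors W))
        ≈⟨ -‿distribʳ-* _ _ ⟩
      a zero * P * - dbl (W zero) u (minors W)
        ≈⟨ *-congˡ (dbl-swap u (W zero) (minors W) (minors-ext W)) ⟨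
      a zero * P * bordered u W ∎
      where
      P : Carrier
      P = ∏[ i < n ] a (suc i)
      s t B : Fin (2 ℕ.+ n) → Carrier
      s j = sign j * u j
      t j = sign j * W zero j
      B j = bordered (u ∘ punchIn j) (λ i k → W (suc i) (punchIn j k))
      rowStep : ∀ j →
        sign j * N zero j * bordered (u ∘ punchIn j) (λ i k → N (suc i) (punchIn j k)) ≈
        P * (s j * B j) + P * (a zero * (t j * B j))
      rowStep j = begin
        sign j * N zero j * bordered (u ∘ punchIn j) (λ i k → N (suc i) (punchIn j k))
          ≈⟨ *-cong (*-congˡ (N≈ zero j))
                    (reduce (u ∘ punchIn j) (a ∘ suc) (λ i k → N (suc i) (punchIn j k))
                            (λ i k → W (suc i) (punchIn j k)) (λ i k → N≈ (suc i) (punchIn j k))) ⟩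
        sign j * (u j + a zero * W zero j) * (P * B j)
          ≈⟨ *.x∙yz≈y∙xz _ _ _ ⟩
        P * (sign j * (u j + a zero * W zero j) * B j)
          ≈⟨ *-congˡ (*-congʳ (distribˡ _ _ _)) ⟩
        P * ((s j + sign j * (a zero * W zero j)) * B j)
          ≈⟨ *-congˡ (*-congʳ (+-congˡ (*.x∙yz≈y∙xz _ _ _))) ⟩
        P * ((s j + a zero * t j) * B j)
          ≈⟨ *-congˡ (trans (distribʳ _ _ _) (+-congˡ (*-assoc _ _ _))) ⟩
        P * (s j * B j + a zero * (t j * B j))
          ≈⟨ distribˡ _ _ _ ⟩
        P * (s j * B j) + P * (a zero * (t j * B j)) ∎

    eval : List Carrier → Carrier → Carrier
    eval []      a = 0#
    eval (b ∷ p) a = b + a * eval p a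

    divDiff : Carrier → List Carrier → List Carrier
    divDiff a []      = []
    divDiff a (b ∷ p) = - eval p a ∷ divDiff a p

    eval-divDiff : ∀ a p b → eval p b ≈ eval p a + (a - b) * eval (divDiff a p) b
    eval-divDiff a []      b = sym (trans (+-identityˡ _) (zeroʳ _))
    eval-divDiff a (e ∷ p) b = begin
      e + b * eval p b
        ≈⟨ +-congˡ (*-congˡ (eval-divDiff a p b)) ⟩
      e + b * (pa + (a - b) * q)
        ≈⟨ +-congˡ (trans (distribˡ _ _ _) (+-congˡ (*.x∙yz≈y∙xz _ _ _))) ⟩
      e + (b * pa + (a - b) * (b * q))
        ≈⟨ +-congˡ (+-congʳ shift) ⟩
      e + ((a * pa + (a - b) * - pa) + (a - b) * (b * q))
        ≈⟨ +-congˡ (+-assoc _ _ _) ⟩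
      e + (a * pa + ((a - b) * - pa + (a - b) * (b * q)))
        ≈⟨ +-assoc _ _ _ ⟨
      (e + a * pa) + ((a - b) * - pa + (a - b) * (b * q))
        ≈⟨ +-congˡ (distribˡ _ _ _) ⟨
      (e + a * pa) + (a - b) * (- pa + b * q) ∎
      where
      pa q : Carrier
      pa = eval p a
      q = eval (divDiff a p) b
      shift : b * pa ≈ a * pa + (a - b) * - pa
      shift = begin
        b * pa                          ≈⟨ a+b-b≈a (b * pa) (a * pa) ⟨
        (b * pa + a * pa) - a * pa      ≈⟨ +-congʳ (+-comm _ _) ⟩
        (a * pa + b * pa) - a * pa      ≈⟨ +-assoc _ _ _ ⟩
        a * pa + (b * pa - a * pa)      ≈⟨ +-congˡ (+-comm _ _) ⟩
        a * pa + (- (a * pa) + b * pa)  ≈⟨ +-congˡ (+-congˡ (-‿involutive _)) ⟨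
        a * pa + (- (a * pa) + - - (b * pa))
                                        ≈⟨ +-congˡ (-‿+-comm _ _) ⟩
        a * pa + - (a * pa - b * pa)    ≈⟨ +-congˡ (-‿cong ([y-z]x≈yx-zx pa a b)) ⟨
        a * pa + - ((a - b) * pa)       ≈⟨ +-congˡ (-‿distribʳ-* _ _) ⟩
        a * pa + (a - b) * - pa         ∎

    Δ∣det-eval : ∀ {n} (v : Fin n → Carrier) (p : Fin n → List Carrier) →
                 Σ[ q ∈ Carrier ] q * Δ v ≈ det (λ i j → eval (p j) (v i))
    Δ∣det-eval {zero}  v p = 1# , *-identityˡ 1#
    Δ∣det-eval {suc n} v p = Q , (begin
      Q * Δ v
        ≈⟨ *-congˡ (Δ-suc v) ⟩
      Q * (P * Δ (v ∘ suc))
        ≈⟨ *.x∙yz≈y∙xz _ _ _ ⟩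
      P * (Q * Δ (v ∘ suc))
        ≈⟨ *-congˡ (*-distribʳ-sum (Δ (v ∘ suc)) (λ j → sign j * u j * proj₁ (rec j))) ⟩
      P * ∑[ j ≤ n ] (sign j * u j * proj₁ (rec j) * Δ (v ∘ suc))
        ≈⟨ *-congˡ (sum-cong (suc n) λ j →
             trans (*-assoc _ _ _) (*-congˡ {x = sign j * u j} (proj₂ (rec j)))) ⟩
      P * bordered u (λ i j → eval (divDiff (v zero) (p j)) (v (suc i)))
        ≈⟨ reduce u (λ i → v zero - v (suc i)) (λ i j → eval (p j) (v (suc i))) _
                  (λ i j → eval-divDiff (v zero) (p j) (v (suc i))) ⟨
      det (λ i j → eval (p j) (v i)) ∎)
      where
      u : Fin (suc n) → Carrier
      u j = eval (p j) (v zero)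
      P : Carrier
      P = ∏[ i < n ] (v zero - v (suc i))
      rec : ∀ j → Σ[ q ∈ Carrier ]
        q * Δ (v ∘ suc) ≈ det (λ i k → eval (divDiff (v zero) (p (punchIn j k))) (v (suc i)))
      rec j = Δ∣det-eval (v ∘ suc) (λ k → divDiff (v zero) (p (punchIn j k)))
      Q : Carrier
      Q = ∑[ j ≤ n ] (sign j * u j * proj₁ (rec j))

    monomial : ℕ → List Carrier
    monomial zero    = 1# ∷ []
    monomial (suc k) = 0# ∷ monomial k

    eval-monomial : ∀ k a → eval (monomial k) a ≈ a ^ k
    eval-monomial zero    a = trans (+-congˡ (zeroʳ a)) (+-identityʳ 1#)
    eval-monomial (suc k) a = trans (+-identityˡ _) (*-congˡ (eval-monomial k a))

  open RowReduction using (Δ∣det-eval; monomial; eval-monomial)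

  Δ∣alternant : ∀ {n} (v : Fin n → Carrier) (e : Fin n → ℕ) →
                Σ[ q ∈ Carrier ] q * Δ v ≈ det (λ i j → v i ^ e j)
  Δ∣alternant v e with q , eq ← Δ∣det-eval v (monomial ∘ e) =
    q , trans eq (det-cong λ i j → eval-monomial (e j) (v i))

  -- The alternant over the Vandermonde product at a tuple v; for v a tuple
  -- of distinct variables this is the Schur polynomial of μ in them.

  schur : ∀ {n} (v : Fin n → Carrier) → Regular (Δ v) → (μ : Partition n) →
          Quotient (det (λ i j → v i ^ exponent μ j)) (Δ v)
  schur v reg μ = quotient reg (Δ∣alternant v (exponent μ))

module PowerSeries {c ℓ} (R : CommutativeRing c ℓ) where

  open RingTheory R
  open SetoidReasoning setoid
  private
    module + = CommutativeSemigroupProperties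
                 (CommutativeMonoid.commutativeSemigroup +-commutativeMonoid)

  -- f k is the coefficient of Xᵏ.

  Series : Set c
  Series = ℕ → Carrier

  infix  4 _≋_
  infixl 6 _⊞_
  infixl 7 _⊛_

  _≋_ : Series → Series → Set ℓ
  f ≋ g = ∀ k → f k ≈ g k

  _⊞_ : Series → Series → Series
  (f ⊞ g) k = f k + g k

  ⊟_ : Series → Series
  (⊟ f) k = - f k

  _⊛_ : Series → Series → Series
  (f ⊛ g) k = ∑[ i ≤ k ] (f (toℕ i) * g (k ∸ toℕ i))

  constant : Carrier → Series
  constant a zero    = a
  constant a (suc k) = 0#

  X : Series
  X zero    = 0#
  X (suc k) = constant 1# k

  ⊛-cong : ∀ {f f′ g g′} → f ≋ f′ → g ≋ g′ → f ⊛ g ≋ f′ ⊛ g′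
  ⊛-cong f≋f′ g≋g′ k = sum-cong (suc k) λ i → *-cong (f≋f′ (toℕ i)) (g≋g′ (k ∸ toℕ i))

  -- (f ⊛ g) (suc k) is f 0 * g (suc k) + (f ∘ suc ⊛ g) k by computation.

  ⊛-last : ∀ f g k → (f ⊛ g) (suc k) ≈ f (suc k) * g 0 + (f ⊛ (g ∘ suc)) k
  ⊛-last f g zero = begin
    f 0 * g 1 + (f 1 * g 0 + 0#)  ≈⟨ +.x∙yz≈y∙xz _ _ _ ⟩
    f 1 * g 0 + (f 0 * g 1 + 0#)  ∎
  ⊛-last f g (suc k) = begin
    f 0 * g (2 ℕ.+ k) + ((f ∘ suc) ⊛ g) (suc k)
      ≈⟨ +-congˡ (⊛-last (f ∘ suc) g k) ⟩
    f 0 * g (2 ℕ.+ k) + (f (2 ℕ.+ k) * g 0 + ((f ∘ suc) ⊛ (g ∘ suc)) k)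
      ≈⟨ +.x∙yz≈y∙xz _ _ _ ⟩
    f (2 ℕ.+ k) * g 0 + (f ⊛ (g ∘ suc)) (suc k) ∎

  ⊛-comm : ∀ f g → f ⊛ g ≋ g ⊛ f
  ⊛-comm f g zero    = +-congʳ (*-comm _ _)
  ⊛-comm f g (suc k) = begin
    f 0 * g (suc k) + ((f ∘ suc) ⊛ g) k  ≈⟨ +-cong (*-comm _ _) (⊛-comm (f ∘ suc) g k) ⟩
    g (suc k) * f 0 + (g ⊛ (f ∘ suc)) k  ≈⟨ ⊛-last g f k ⟨
    (g ⊛ f) (suc k)                      ∎

  ⊛-distribʳ : ∀ h f g → (f ⊞ g) ⊛ h ≋ (f ⊛ h) ⊞ (g ⊛ h)
  ⊛-distribʳ h f g k = trans
    (sum-cong (suc k) λ i → distribʳ (h (k ∸ toℕ i)) (f (toℕ i)) (g (toℕ i)))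
    (∑-distrib-+ (λ i → f (toℕ i) * h (k ∸ toℕ i)) (λ (i : Fin (suc k)) → g (toℕ i) * h (k ∸ toℕ i)))

  ⊛-distribˡ : ∀ h f g → h ⊛ (f ⊞ g) ≋ (h ⊛ f) ⊞ (h ⊛ g)
  ⊛-distribˡ h f g k = begin
    (h ⊛ (f ⊞ g)) k         ≈⟨ ⊛-comm h (f ⊞ g) k ⟩
    ((f ⊞ g) ⊛ h) k         ≈⟨ ⊛-distribʳ h f g k ⟩
    (f ⊛ h) k + (g ⊛ h) k   ≈⟨ +-cong (⊛-comm f h k) (⊛-comm g h k) ⟩
    (h ⊛ f) k + (h ⊛ g) k   ∎

  ⊛-zeroˡ : ∀ f → (λ _ → 0#) ⊛ f ≋ (λ _ → 0#)
  ⊛-zeroˡ f k = sum-0 (suc k) λ i → zeroˡ (f (k ∸ toℕ i))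

  ⊛-scaleˡ : ∀ a f g → (λ k → a * f k) ⊛ g ≋ (λ k → a * (f ⊛ g) k)
  ⊛-scaleˡ a f g k = trans
    (sum-cong (suc k) λ i → *-assoc a (f (toℕ i)) (g (k ∸ toℕ i)))
    (sym (*-distribˡ-sum a (λ (i : Fin (suc k)) → f (toℕ i) * g (k ∸ toℕ i))))

  constant-⊛ : ∀ a f → constant a ⊛ f ≋ (λ k → a * f k)
  constant-⊛ a f zero    = +-identityʳ _
  constant-⊛ a f (suc k) = trans (+-congˡ (⊛-zeroˡ f k)) (+-identityʳ _)

  ⊛-identityˡ : ∀ f → constant 1# ⊛ f ≋ f
  ⊛-identityˡ f k = trans (constant-⊛ 1# f k) (*-identityˡ _)

  X-⊛-zero : ∀ f → (X ⊛ f) 0 ≈ 0#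
  X-⊛-zero f = trans (+-identityʳ _) (zeroˡ _)

  X-⊛-suc : ∀ f k → (X ⊛ f) (suc k) ≈ f k
  X-⊛-suc f k = begin
    0# * f (suc k) + (constant 1# ⊛ f) k  ≈⟨ +-cong (zeroˡ _) (⊛-identityˡ f k) ⟩
    0# + f k                              ≈⟨ +-identityˡ _ ⟩
    f k                                   ∎

  ⊛-assoc : ∀ f g h → (f ⊛ g) ⊛ h ≋ f ⊛ (g ⊛ h)
  ⊛-assoc f g h zero = +-congʳ (begin
    (f 0 * g 0 + 0#) * h 0  ≈⟨ *-congʳ (+-identityʳ _) ⟩
    f 0 * g 0 * h 0         ≈⟨ *-assoc _ _ _ ⟩
    f 0 * (g 0 * h 0)       ≈⟨ *-congˡ (+-identityʳ _) ⟨
    f 0 * (g 0 * h 0 + 0#)  ∎)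
  ⊛-assoc f g h (suc k) = begin
    (f 0 * g 0 + 0#) * h (suc k) + (((λ i → f 0 * g (suc i)) ⊞ ((f ∘ suc) ⊛ g)) ⊛ h) k
      ≈⟨ +-cong (trans (*-congʳ (+-identityʳ _)) (*-assoc _ _ _))
                (⊛-distribʳ h (λ i → f 0 * g (suc i)) ((f ∘ suc) ⊛ g) k) ⟩
    f 0 * (g 0 * h (suc k)) + (((λ i → f 0 * g (suc i)) ⊛ h) k + (((f ∘ suc) ⊛ g) ⊛ h) k)
      ≈⟨ +-congˡ (+-cong (⊛-scaleˡ (f 0) (g ∘ suc) h k) (⊛-assoc (f ∘ suc) g h k)) ⟩
    f 0 * (g 0 * h (suc k)) + (f 0 * ((g ∘ suc) ⊛ h) k + ((f ∘ suc) ⊛ (g ⊛ h)) k)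
      ≈⟨ +-assoc _ _ _ ⟨
    (f 0 * (g 0 * h (suc k)) + f 0 * ((g ∘ suc) ⊛ h) k) + ((f ∘ suc) ⊛ (g ⊛ h)) k
      ≈⟨ +-congʳ (distribˡ _ _ _) ⟨
    (f ⊛ (g ⊛ h)) (suc k) ∎

  isCommutativeRing-⊛ : IsCommutativeRing _≋_ _⊞_ _⊛_ ⊟_ (λ _ → 0#) (constant 1#)
  isCommutativeRing-⊛ = record
    { isRing = record
      { +-isAbelianGroup = record
        { isGroup = record
          { isMonoid = record
            { isSemigroup = record
              { isMagma = record
                { isEquivalence = record
                  { refl  = λ k → refl
                  ; sym   = λ f≋g k → sym (f≋g k)
                  ; trans = λ f≋g g≋h k → trans (f≋g k) (g≋h k)
                  }
                ; ∙-cong = λ f≋g h≋l k → +-cong (f≋g k) (h≋l k)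
                }
              ; assoc = λ f g h k → +-assoc (f k) (g k) (h k)
              }
            ; identity = (λ f k → +-identityˡ (f k)) , (λ f k → +-identityʳ (f k))
            }
          ; inverse = (λ f k → -‿inverseˡ (f k)) , (λ f k → -‿inverseʳ (f k))
          ; ⁻¹-cong = λ f≋g k → -‿cong (f≋g k)
          }
        ; comm = λ f g k → +-comm (f k) (g k)
        }
      ; *-cong = ⊛-cong
      ; *-assoc = ⊛-assoc
      ; *-identity = ⊛-identityˡ , λ f k → trans (⊛-comm f (constant 1#) k) (⊛-identityˡ f k)
      ; distrib = ⊛-distribˡ , ⊛-distribʳ
      }
    ; *-comm = ⊛-comm
    }

  -- The subring of series with only finitely many nonzero coefficients.

  record Polynomial : Set (c ⊔ ℓ) where
    field
      coefficient : Series
      bound       : ℕ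
      vanishes    : ∀ k → bound ≤ k → coefficient k ≈ 0#

  open Polynomial

  private
    split : ∀ d e k i → d ℕ.+ e ≤ k → d ≤ i ⊎ e ≤ k ∸ i
    split d e k i d+e≤k with ℕ.≤-total d i
    ... | inj₁ d≤i = inj₁ d≤i
    ... | inj₂ i≤d = inj₂ (ℕ.≤-trans
            (ℕ.≤-reflexive (≡.sym (ℕ.m+n∸m≡n d e)))
            (ℕ.∸-mono d+e≤k i≤d))

  polynomialRawRing : RawRing (c ⊔ ℓ) ℓ
  polynomialRawRing = record
    { Carrier = Polynomial
    ; _≈_ = λ p q → coefficient p ≋ coefficient q
    ; _+_ = λ p q → record
      { coefficient = coefficient p ⊞ coefficient q
      ; bound       = bound p ℕ.+ bound q
      ; vanishes    = λ k b≤k → trans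
          (+-cong (vanishes p k (ℕ.m+n≤o⇒m≤o (bound p) b≤k))
                  (vanishes q k (ℕ.m+n≤o⇒n≤o (bound p) b≤k)))
          (+-identityˡ 0#)
      }
    ; _*_ = λ p q → record
      { coefficient = coefficient p ⊛ coefficient q
      ; bound       = bound p ℕ.+ bound q
      ; vanishes    = λ k b≤k → sum-0 (suc k) (product-vanishes p q k b≤k)
      }
    ; -_ = λ p → record
      { coefficient = ⊟ coefficient p
      ; bound       = bound p
      ; vanishes    = λ k b≤k → trans (-‿cong (vanishes p k b≤k)) -0#≈0#
      }
    ; 0# = record { coefficient = λ _ → 0# ; bound = 0 ; vanishes = λ _ _ → refl }
    ; 1# = record { coefficient = constant 1# ; bound = 1 ; vanishes = λ { (suc k) _ → refl } }
    }
    where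
    product-vanishes : ∀ p q k → bound p ℕ.+ bound q ≤ k → (i : Fin (suc k)) →
                       coefficient p (toℕ i) * coefficient q (k ∸ toℕ i) ≈ 0#
    product-vanishes p q k b≤k i with split (bound p) (bound q) k (toℕ i) b≤k
    ... | inj₁ b≤i   = trans (*-congʳ (vanishes p _ b≤i)) (zeroˡ _)
    ... | inj₂ b≤k-i = trans (*-congˡ (vanishes q _ b≤k-i)) (zeroʳ _)

  isCommutativeRing-polynomial :
    let open RawRing polynomialRawRing renaming
          (_≈_ to _≈ₚ_; _+_ to _+ₚ_; _*_ to _*ₚ_; -_ to -ₚ_; 0# to 0ₚ; 1# to 1ₚ)
    in IsCommutativeRing _≈ₚ_ _+ₚ_ _*ₚ_ -ₚ_ 0ₚ 1ₚ
  isCommutativeRing-polynomial =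
    RingMonomorphism.isCommutativeRing coefficient-isMonomorphism isCommutativeRing-⊛
    where
    seriesRawRing : RawRing c ℓ
    seriesRawRing = record
      { _≈_ = _≋_ ; _+_ = _⊞_ ; _*_ = _⊛_ ; -_ = ⊟_ ; 0# = λ _ → 0# ; 1# = constant 1# }
    coefficient-isMonomorphism : IsRingMonomorphism polynomialRawRing seriesRawRing coefficient
    coefficient-isMonomorphism = record
      { isRingHomomorphism = record
        { isSemiringHomomorphism = record
          { isNearSemiringHomomorphism = record
            { +-isMonoidHomomorphism = record
              { isMagmaHomomorphism = record
                { isRelHomomorphism = record { cong = λ p≈q → p≈q }
                ; homo = λ _ _ _ → refl
                }
              ; ε-homo = λ _ → refl
              }
            ; *-homo = λ _ _ _ → refl
            }
          ; 1#-homo = λ _ → refl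
          }
        ; -‿homo = λ _ _ → refl
        }
      ; injective = λ p≈q → p≈q
      }

  indeterminate : Polynomial
  indeterminate = record
    { coefficient = X ; bound = 2 ; vanishes = λ { (suc zero) (s≤s ()) ; (suc (suc k)) _ → refl } }

infix 8 _⟦X⟧ _[X]

_⟦X⟧ : ∀ {c ℓ} → CommutativeRing c ℓ → CommutativeRing c ℓ
R ⟦X⟧ = record { isCommutativeRing = PowerSeries.isCommutativeRing-⊛ R }

_[X] : ∀ {c ℓ} → CommutativeRing c ℓ → CommutativeRing (c ⊔ ℓ) ℓ
R [X] = record { isCommutativeRing = PowerSeries.isCommutativeRing-polynomial R }

infix 8 _⟦_⟧

_⟦_⟧ : ∀ {c ℓ} → CommutativeRing c ℓ → ℕ → CommutativeRing c ℓ
R ⟦ zero ⟧  = R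
R ⟦ suc m ⟧ = R ⟦ m ⟧ ⟦X⟧

module MultivariateSeries {c ℓ} (R : CommutativeRing c ℓ) where

  private
    module R = RingTheory R
    module S (m : ℕ) = RingTheory (R ⟦ m ⟧)

  const : ∀ m → R.Carrier → S.Carrier m
  const zero    a = a
  const (suc m) a = PowerSeries.constant (R ⟦ m ⟧) (const m a)

  var : ∀ {m} → Fin m → S.Carrier m
  var {suc m} zero    = PowerSeries.X (R ⟦ m ⟧)
  var {suc m} (suc i) = PowerSeries.constant (R ⟦ m ⟧) (var i)

  coeff : ∀ {m} → Vec ℕ m → S.Carrier m → R.Carrier
  coeff []      f = f
  coeff (k ∷ a) f = coeff a (f k)

  fromCoeff : ∀ {m} → (Vec ℕ m → R.Carrier) → S.Carrier m
  fromCoeff {zero}  φ   = φ []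
  fromCoeff {suc m} φ k = fromCoeff (λ a → φ (k ∷ a))

  -- Unordered summation: every coefficient is attained by all sufficiently
  -- large finite partial sums.

  HasSum : ∀ m {I : Set} → (I → S.Carrier m) → S.Carrier m → Set ℓ
  HasSum m {I} f s = ∀ (a : Vec ℕ m) → ∃[ F ] ∀ (G : List I) → Unique G → F ⊆ G →
    coeff a (foldr (S._+_ m) (S.0# m) (map f G)) R.≈ coeff a s

  -- The infinite sum 1 + u + u² + ⋯ for u without constant term: powers beyond the degree
  -- of a monomial do not contribute to its coefficient.

  geometric : ∀ m → S.Carrier m → S.Carrier m
  geometric m u = fromCoeff λ (a : Vec ℕ m) → coeff a (∑[ k ≤ Vec.sum a ] (u ^ toℕ k))
    where open S m

  coeff-cong : ∀ {m} (a : Vec ℕ m) {f g} → S._≈_ m f g → coeff a f R.≈ coeff a g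
  coeff-cong []      f≈g = f≈g
  coeff-cong (k ∷ a) f≈g = coeff-cong a (f≈g k)

  coeff-ext : ∀ m {f g} → (∀ (a : Vec ℕ m) → coeff a f R.≈ coeff a g) → S._≈_ m f g
  coeff-ext zero    f≈g   = f≈g []
  coeff-ext (suc m) f≈g k = coeff-ext m λ a → f≈g (k ∷ a)

  coeff-+ : ∀ {m} (a : Vec ℕ m) f g → coeff a (S._+_ m f g) R.≈ coeff a f R.+ coeff a g
  coeff-+ []      f g = R.refl
  coeff-+ (k ∷ a) f g = coeff-+ a (f k) (g k)

  coeff-neg : ∀ {m} (a : Vec ℕ m) f → coeff a (S.-_ m f) R.≈ R.- coeff a f
  coeff-neg []      f = R.refl
  coeff-neg (k ∷ a) f = coeff-neg a (f k)

  coeff-0 : ∀ {m} (a : Vec ℕ m) → coeff a (S.0# m) R.≈ R.0#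
  coeff-0 []      = R.refl
  coeff-0 (k ∷ a) = coeff-0 a

  coeff-sum : ∀ {m} (a : Vec ℕ m) n (f : Fin n → S.Carrier m) →
              coeff a (S.sum m f) R.≈ R.sum (λ i → coeff a (f i))
  coeff-sum a zero    f = coeff-0 a
  coeff-sum a (suc n) f = R.trans (coeff-+ a _ _) (R.+-congˡ (coeff-sum a n (f ∘ suc)))

  coeff-fromCoeff : ∀ {m} φ (a : Vec ℕ m) → coeff a (fromCoeff φ) ≡ φ a
  coeff-fromCoeff φ []      = ≡.refl
  coeff-fromCoeff φ (k ∷ a) = coeff-fromCoeff (λ b → φ (k ∷ b)) a

  Order≥ : ∀ m → ℕ → S.Carrier m → Set ℓ
  Order≥ m N f = ∀ (a : Vec ℕ m) → Vec.sum a < N → coeff a f R.≈ R.0#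

  order-+ : ∀ m N f g → Order≥ m N f → Order≥ m N g → Order≥ m N (S._+_ m f g)
  order-+ m N f g of og a a<N =
    R.trans (coeff-+ a f g) (R.trans (R.+-cong (of a a<N) (og a a<N)) (R.+-identityˡ R.0#))

  order-neg : ∀ m N f → Order≥ m N f → Order≥ m N (S.-_ m f)
  order-neg m N f of a a<N = R.trans (coeff-neg a f) (R.trans (R.-‿cong (of a a<N)) R.-0#≈0#)

  order-at : ∀ m N f k → Order≥ (suc m) N f → Order≥ m (N ∸ k) (f k)
  order-at m N f k of a a<N-k = of (k ∷ a) (shift N k a<N-k)
    where
    shift : ∀ N k {d} → d < N ∸ k → k ℕ.+ d < N
    shift N       zero    d<N   = d<N
    shift (suc N) (suc k) d<N-k = s≤s (shift N k d<N-k)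

  order-* : ∀ m M N f g → Order≥ m M f → Order≥ m N g → Order≥ m (M ℕ.+ N) (S._*_ m f g)
  order-* zero zero    N f g of og [] 0<N = R.trans (R.*-congˡ (og [] 0<N)) (R.zeroʳ f)
  order-* zero (suc M) N f g of og [] _   = R.trans (R.*-congʳ (of [] (s≤s z≤n))) (R.zeroˡ g)
  order-* (suc m) M N f g of og (k ∷ a) k+a<M+N = R.trans
    (coeff-sum a (suc k) (λ i → S._*_ m (f (toℕ i)) (g (k ∸ toℕ i))))
    (R.sum-0 (suc k) λ i →
      order-* m (M ∸ toℕ i) (N ∸ (k ∸ toℕ i)) (f (toℕ i)) (g (k ∸ toℕ i))
        (order-at m M f (toℕ i) of) (order-at m N g (k ∸ toℕ i) og) a
        (bound (toℕ i) (toℕ≤pred[n] i)))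
    where
    bound : ∀ i → i ≤ k → Vec.sum a < (M ∸ i) ℕ.+ (N ∸ (k ∸ i))
    bound i i≤k = ℕ.+-cancelˡ-< k _ _ (ℕ.<-≤-trans k+a<M+N (begin
      M ℕ.+ N
        ≤⟨ ℕ.+-mono-≤ (ℕ.m≤n+m∸n M i) (ℕ.m≤n+m∸n N (k ∸ i)) ⟩
      (i ℕ.+ (M ∸ i)) ℕ.+ ((k ∸ i) ℕ.+ (N ∸ (k ∸ i)))
        ≡⟨ ℕ+.interchange i (M ∸ i) (k ∸ i) (N ∸ (k ∸ i)) ⟩
      (i ℕ.+ (k ∸ i)) ℕ.+ ((M ∸ i) ℕ.+ (N ∸ (k ∸ i)))
        ≡⟨ ≡.cong (ℕ._+ ((M ∸ i) ℕ.+ (N ∸ (k ∸ i)))) (ℕ.m+[n∸m]≡n i≤k) ⟩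
      k ℕ.+ ((M ∸ i) ℕ.+ (N ∸ (k ∸ i))) ∎))
      where
      open ℕ.≤-Reasoning
      module ℕ+ = CommutativeSemigroupProperties ℕ.+-commutativeSemigroup

  order-^ : ∀ m u → Order≥ m 1 u → ∀ k → Order≥ m k (S._^_ m u k)
  order-^ m u ou zero    a ()
  order-^ m u ou (suc k) = order-* m 1 k u _ ou (order-^ m u ou k)

  order-var : ∀ {m} (i : Fin m) → Order≥ m 1 (var i)
  order-var zero    (zero ∷ a)  _   = coeff-0 a
  order-var (suc i) (zero ∷ a)  a<1 = order-var i a a<1
  order-var zero    (suc k ∷ a) (s≤s ())
  order-var (suc i) (suc k ∷ a) (s≤s ())

  module _ (m : ℕ) where

    open S m
    open SetoidReasoning setoid

    partialSum : Carrier → ℕ → Carrier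
    partialSum u N = ∑[ k ≤ N ] (u ^ toℕ k)

    partialSum-first : ∀ u N → partialSum u (suc N) ≈ 1# + u * partialSum u N
    partialSum-first u N = +-congˡ (sym (*-distribˡ-sum u (λ (k : Fin (suc N)) → u ^ toℕ k)))

    partialSum-last : ∀ u N → partialSum u (suc N) ≈ partialSum u N + u ^ suc N
    partialSum-last u zero = begin
      1# + (u * 1# + 0#)  ≈⟨ +-congˡ (+-identityʳ _) ⟩
      1# + u * 1#         ≈⟨ +-congʳ (+-identityʳ 1#) ⟨
      (1# + 0#) + u * 1#  ∎
    partialSum-last u (suc N) = begin
      partialSum u (2 ℕ.+ N)                            ≈⟨ partialSum-first u (suc N) ⟩
      1# + u * partialSum u (suc N)                     ≈⟨ +-congˡ (*-congˡ (partialSum-last u N)) ⟩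
      1# + u * (partialSum u N + u ^ suc N)             ≈⟨ +-congˡ (distribˡ _ _ _) ⟩
      1# + (u * partialSum u N + u ^ (2 ℕ.+ N))         ≈⟨ +-assoc _ _ _ ⟨
      (1# + u * partialSum u N) + u ^ (2 ℕ.+ N)         ≈⟨ +-congʳ (partialSum-first u N) ⟨
      partialSum u (suc N) + u ^ (2 ℕ.+ N)              ∎

    telescope : ∀ u N → (1# - u) * partialSum u N ≈ 1# - u ^ suc N
    telescope u N = begin
      (1# - u) * s           ≈⟨ [y-z]x≈yx-zx s 1# u ⟩
      1# * s - u * s         ≈⟨ +-congʳ (*-identityˡ s) ⟩
      s - u * s              ≈⟨ +-congʳ (a+b-b≈a s p) ⟨
      ((s + p) - p) - u * s  ≈⟨ +-congʳ (+-congʳ (trans (sym (partialSum-last u N)) (partialSum-first u N))) ⟩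
      ((1# + u * s) - p) - u * s
                             ≈⟨ +-assoc _ _ _ ⟩
      (1# + u * s) + (- p - u * s)
                             ≈⟨ +-congˡ (+-comm _ _) ⟩
      (1# + u * s) + (- (u * s) - p)
                             ≈⟨ +-assoc _ _ _ ⟨
      ((1# + u * s) - u * s) - p
                             ≈⟨ +-congʳ (a+b-b≈a 1# (u * s)) ⟩
      1# - p                 ∎
      where
      s p : Carrier
      s = partialSum u N
      p = u ^ suc N

    partialSum-stable : ∀ u → Order≥ m 1 u → ∀ (a : Vec ℕ m) d →
      coeff a (partialSum u (d ℕ.+ Vec.sum a)) R.≈ coeff a (partialSum u (Vec.sum a))
    partialSum-stable u ou a zero    = R.refl
    partialSum-stable u ou a (suc d) = R.trans
      (coeff-cong a (partialSum-last u (d ℕ.+ Vec.sum a)))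
      (R.trans (coeff-+ a (partialSum u (d ℕ.+ Vec.sum a)) (u ^ suc (d ℕ.+ Vec.sum a)))
      (R.trans (R.+-cong (partialSum-stable u ou a d)
                         (order-^ m u ou (suc (d ℕ.+ Vec.sum a)) a (s≤s (ℕ.m≤n+m _ d))))
               (R.+-identityʳ _)))

    geometric-inverse : ∀ u → Order≥ m 1 u → (1# - u) * geometric m u ≈ 1#
    geometric-inverse u ou = coeff-ext m λ a → let
        N = Vec.sum a
        s = partialSum u N
        close : Order≥ m (suc N) (geometric m u - s)
        close b b<1+N = R.trans (coeff-+ b (geometric m u) (- s)) (R.trans
          (R.+-cong
            (R.reflexive (coeff-fromCoeff (λ c → coeff c (partialSum u (Vec.sum c))) b))
            (R.trans (coeff-neg b s) (R.-‿cong (R.trans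
              (R.reflexive (≡.cong (λ k → coeff b (partialSum u k))
                (≡.sym (ℕ.m∸n+n≡m (ℕ.≤-pred b<1+N)))))
              (partialSum-stable u ou b (N ∸ Vec.sum b))))))
          (R.-‿inverseʳ _))
        split : (1# - u) * geometric m u ≈ 1# + ((1# - u) * (geometric m u - s) - u ^ suc N)
        split = begin
          (1# - u) * geometric m u
            ≈⟨ *-congˡ (a-b+b≈a (geometric m u) s) ⟨
          (1# - u) * ((geometric m u - s) + s)
            ≈⟨ distribˡ _ _ _ ⟩
          (1# - u) * (geometric m u - s) + (1# - u) * s
            ≈⟨ +-congˡ (telescope u N) ⟩
          (1# - u) * (geometric m u - s) + (1# - u ^ suc N)
            ≈⟨ +-assoc _ _ _ ⟨
          ((1# - u) * (geometric m u - s) + 1#) - u ^ suc N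
            ≈⟨ +-congʳ (+-comm _ _) ⟩
          (1# + (1# - u) * (geometric m u - s)) - u ^ suc N
            ≈⟨ +-assoc _ _ _ ⟩
          1# + ((1# - u) * (geometric m u - s) - u ^ suc N) ∎
      in R.trans (coeff-cong a split)
         (R.trans (coeff-+ a 1# _)
         (R.trans (R.+-congˡ (order-+ m (suc N) ((1# - u) * (geometric m u - s)) (- u ^ suc N)
             (order-* m 0 (suc N) (1# - u) (geometric m u - s) (λ _ ()) close)
             (order-neg m (suc N) (u ^ suc N) (order-^ m u ou (suc N))) a ℕ.≤-refl))
           (R.+-identityʳ _)))

  module _ (m : ℕ) where

    open PowerSeries (R ⟦ m ⟧) using (constant; X; ⊛-comm; constant-⊛; X-⊛-zero; X-⊛-suc)
    open S m
    open SetoidReasoning setoid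
    private module P = S (suc m)

    constant-regular : ∀ a → Regular a → P.Regular (constant a)
    constant-regular a reg q q*a≈0 k = reg (q k) $ begin
      q k * a                ≈⟨ *-comm _ _ ⟩
      a * q k                ≈⟨ constant-⊛ a q k ⟨
      (constant a P.* q) k   ≈⟨ ⊛-comm (constant a) q k ⟩
      (q P.* constant a) k   ≈⟨ q*a≈0 k ⟩
      0#                     ∎

    X-regular : P.Regular X
    X-regular q q*X≈0 k = begin
      q k                ≈⟨ X-⊛-suc q k ⟨
      (X P.* q) (suc k)  ≈⟨ ⊛-comm X q (suc k) ⟩
      (q P.* X) (suc k)  ≈⟨ q*X≈0 (suc k) ⟩
      0#                 ∎

    X-constant-regular : ∀ a → Regular a → P.Regular (X P.- constant a)
    X-constant-regular a reg q q*≈0 = vanish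
      where
      expand : ∀ k → (X P.* q) k - a * q k ≈ 0#
      expand k = begin
        (X P.* q) k - a * q k                   ≈⟨ +-congˡ (-‿cong (constant-⊛ a q k)) ⟨
        (X P.* q) k - (constant a P.* q) k      ≈⟨ P.[y-z]x≈yx-zx q X (constant a) k ⟨
        ((X P.- constant a) P.* q) k            ≈⟨ ⊛-comm (X P.- constant a) q k ⟩
        (q P.* (X P.- constant a)) k            ≈⟨ q*≈0 k ⟩
        0#                                      ∎
      cancel : ∀ k → (X P.* q) k ≈ 0# → q k ≈ 0#
      cancel k Xq≈0 = reg (q k) (begin
        q k * a      ≈⟨ *-comm _ _ ⟩
        a * q k      ≈⟨ a-b≈0⇒a≈b (expand k) ⟨
        (X P.* q) k  ≈⟨ Xq≈0 ⟩
        0#           ∎)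
      vanish : ∀ k → q k ≈ 0#
      vanish zero    = cancel 0 (X-⊛-zero q)
      vanish (suc k) = cancel (suc k) (trans (X-⊛-suc q k) (vanish k))

    constant-minus : ∀ a b → constant (a - b) P.≈ constant a P.- constant b
    constant-minus a b zero    = refl
    constant-minus a b (suc k) = sym (-‿inverseʳ 0#)

  var-regular : ∀ {m} (i : Fin m) → S.Regular m (var i)
  var-regular {suc m} zero    = X-regular m
  var-regular {suc m} (suc i) = constant-regular m (var i) (var-regular i)

  var-var-regular : ∀ {m} (i j : Fin m) → i ≢ j → S.Regular m (S._-_ m (var i) (var j))
  var-var-regular {suc m} zero    zero    i≢j = ⊥-elim (i≢j ≡.refl)
  var-var-regular {suc m} zero    (suc j) i≢j = X-constant-regular m (var j) (var-regular j)
  var-var-regular {suc m} (suc i) zero    i≢j = P.regular-resp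
    (P.trans (P.sym (P.-‿+-comm _ _)) (P.trans (P.+-congˡ (P.-‿involutive _)) (P.+-comm _ _)))
    (P.regular-neg (X-constant-regular m (var i) (var-regular i)))
    where module P = S (suc m)
  var-var-regular {suc m} (suc i) (suc j) i≢j = S.regular-resp (suc m)
    (constant-minus m (var i) (var j))
    (constant-regular m _ (var-var-regular i j (i≢j ∘ ≡.cong suc)))

  Δ-regular : ∀ {n} m (ι : Fin n → Fin m) → (∀ {i j} → ι i ≡ ι j → i ≡ j) →
              S.Regular m (S.Δ m (var ∘ ι))
  Δ-regular {n} m ι ι-injective = regular-∏ {n} _ λ i → regular-∏ {n} _ λ j → factor i j
    where
    open S m
    factor : ∀ i j → Regular (if does (i <? j) then var (ι i) - var (ι j) else 1#)
    factor i j with toℕ i ℕ.<ᵇ toℕ j in i<ᵇj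
    ... | true  = var-var-regular (ι i) (ι j) λ eq →
                    <⇒≢ (ℕ.<ᵇ⇒< (toℕ i) (toℕ j) (≡.subst T (≡.sym i<ᵇj) tt)) (ι-injective eq)
    ... | false = regular-1

module Variables (n : ℕ) where

  ℤ[t] : CommutativeRing 0ℓ 0ℓ
  ℤ[t] = ℤ.+-*-commutativeRing [X]

  open RingTheory (ℤ[t] ⟦ n ℕ.+ n ⟧) public

  private module ℤ[t]⟦x,y⟧ = MultivariateSeries ℤ[t]

  t : Carrier
  t = ℤ[t]⟦x,y⟧.const (n ℕ.+ n) (PowerSeries.indeterminate ℤ.+-*-commutativeRing)

  x y : Fin n → Carrier
  x i = ℤ[t]⟦x,y⟧.var (i ↑ˡ n)
  y j = ℤ[t]⟦x,y⟧.var (n ↑ʳ j)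

  geometric : Carrier → Carrier
  geometric = ℤ[t]⟦x,y⟧.geometric (n ℕ.+ n)

  HasSum : (Partition n → Carrier) → Carrier → Set
  HasSum = ℤ[t]⟦x,y⟧.HasSum (n ℕ.+ n)

  schurˣ schurʸ : Partition n → Carrier
  schurˣ μ = Quotient.value (schur x (ℤ[t]⟦x,y⟧.Δ-regular (n ℕ.+ n) (_↑ˡ n) (↑ˡ-injective n _ _)) μ)
  schurʸ μ = Quotient.value (schur y (ℤ[t]⟦x,y⟧.Δ-regular (n ℕ.+ n) (n ↑ʳ_) (↑ʳ-injective n _ _)) μ)

{-# OPTIONS --safe #-}

-- By partial fractions the (i, j) entry of the determinant is Σₖ (1 - tᵏ⁺¹) xᵢᵏ yⱼᵏ. Cutting
-- the entries at k < K changes the determinant only in order ≥ K, and the Cauchy–Binet formula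
-- turns the truncated determinant into the sum over the partitions whose shifted parts λⱼ - j + n
-- are all < K. Cauchy–Binet is proved by induction on K: raising K is a rank one update of the
-- matrix, and expanding the determinant along it adds the strictly decreasing sequences that start
-- with K. A factor xᵢ - xⱼ raises the order of a series by no more than 1, so dividing by Δ x Δ y
-- loses only a bounded amount of order and the quotients of the truncations converge.

module Submission where

open import Algebra.Bundles using (CommutativeMonoid; CommutativeRing)
import Algebra.Properties.CommutativeSemigroup as CommutativeSemigroupProperties
import Algebra.Properties.CommutativeSemiring.Exp as CommutativeExp
import Algebra.Solver.Ring.NaturalCoefficients.Default as SemiringSolver
open import Data.Bool.Base as Bool using (true; false; if_then_else_)
open import Data.Empty using (⊥-elim)
open import Data.Fin.Base using (Fin; zero; suc; toℕ; punchIn; punchOut; _↑ˡ_; _↑ʳ_)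
open import Data.Fin.Properties as Fin
  using (toℕ<n; _<?_; <⇒≢; punchIn-punchOut; all?; ¬∀⟶∃¬; ↑ˡ-injective; ↑ʳ-injective)
open import Data.List.Base using (List; []; _∷_; map; foldr; _++_)
open import Data.List.Membership.Propositional using (_∈_)
open import Data.List.Membership.Propositional.Properties using (∈-map⁺; ∈-++⁺ˡ; ∈-++⁺ʳ; ∈-∃++)
open import Data.List.Properties using (map-∘; map-++)
open import Data.List.Relation.Binary.Permutation.Propositional as ↭ using (_↭_)
open import Data.List.Relation.Binary.Permutation.Propositional.Properties using (∈-resp-↭; shift)
import Data.List.Relation.Binary.Permutation.Setoid.Properties as PermutationSetoid
open import Data.List.Relation.Binary.Subset.Propositional using (_⊆_)
open import Data.List.Relation.Unary.All as All using ()
import Data.List.Relation.Unary.All.Properties as All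
open import Data.List.Relation.Unary.AllPairs as AllPairs using (AllPairs; []; _∷_)
import Data.List.Relation.Unary.AllPairs.Properties as AllPairs
open import Data.List.Relation.Unary.Any using (here; there)
open import Data.List.Relation.Unary.Unique.Propositional using (Unique)
open import Data.Nat.Base as ℕ using (ℕ; zero; suc; _≤_; _<_; _≥_; _∸_; z≤n; s≤s; NonZero)
import Data.Nat.Properties as ℕ
open import Data.Product.Base using (Σ-syntax; ∃-syntax; _,_; proj₁; proj₂)
open import Data.Sum.Base using (_⊎_; inj₁; inj₂)
open import Data.Unit.Base using (tt)
open import Data.Vec.Base as Vec using (Vec; []; _∷_; lookup)
open import Data.Vec.Relation.Unary.Linked as Linked using (Linked; []; [-]; _∷_)
import Data.Vec.Relation.Unary.Linked.Properties as Linked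
open import Function.Base using (_∘_)
open import Level using (_⊔_)
open import Relation.Binary.PropositionalEquality as ≡ using (_≡_; _≢_)
import Relation.Binary.Reasoning.Setoid as SetoidReasoning
open import Relation.Nullary using (yes; no; contradiction)
open import Relation.Nullary.Decidable using (does; recompute)
open import Defs

-- Partitions whose exponents are bounded, enumerated as strictly decreasing sequences.

BoundedPartition : ℕ → ℕ → Set
BoundedPartition n K = Σ[ μ ∈ Partition n ] (∀ j → exponent μ j < K)

exponent-decreasing : ∀ {n} (μ : Partition (suc n)) j → exponent μ (suc j) < exponent μ zero
exponent-decreasing (partition ps d) j = ℕ.+-mono-≤-<
  -- The irrelevant field `d` cannot be used directly; decidability of `Linked` recomputes it.
  (Linked.lookup⁺ (λ i≥j j≥k → ℕ.≤-trans j≥k i≥j) (recompute (Linked.linked? ℕ._≥?_ ps) d) (s≤s z≤n))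
  (ℕ.∸-monoʳ-< (s≤s z≤n) (toℕ<n j))

-- In length `suc n` the first part is shifted by `n`, so the part `K ∸ n` has exponent `K`. The
-- other exponents are unchanged by computation.
prepend : ∀ {n K} → BoundedPartition n K → Partition (suc n)
prepend {n} {K} (partition ps d , bound) = partition ((K ∸ n) ∷ ps) (linked ps bound d)
  where
  linked : ∀ {n} (ps : Vec ℕ n) → (∀ j → lookup ps j ℕ.+ (n ∸ suc (toℕ j)) < K) →
           Linked _≥_ ps → Linked _≥_ ((K ∸ n) ∷ ps)
  linked {n} [] bound d = [-]
  linked {suc n} (p ∷ ps) bound d =
    ℕ.m+n≤o⇒m≤o∸n p (ℕ.≤-trans (ℕ.≤-reflexive (ℕ.+-suc p n)) (bound zero)) ∷ d

exponent-prepend-zero : ∀ {n K} (μ : BoundedPartition n K) → exponent (prepend μ) zero ≡ K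
exponent-prepend-zero {zero}      _           = ℕ.+-identityʳ _
-- The bound on the first exponent of `μ` forces `suc n ≤ K`, so the truncated subtraction is exact.
exponent-prepend-zero {suc n} {K} (μ , bound) =
  ℕ.m∸n+n≡m (ℕ.≤-trans (s≤s (ℕ.m≤n+m n _)) (bound zero))

prependᵇ : ∀ {n K} → BoundedPartition n K → BoundedPartition (suc n) (suc K)
prependᵇ {n} {K} μ = prepend μ , bound′
  where
  bound′ : ∀ j → exponent (prepend μ) j < suc K
  bound′ zero    = s≤s (ℕ.≤-reflexive (exponent-prepend-zero μ))
  bound′ (suc j) = ℕ.m<n⇒m<1+n (proj₂ μ j)

weaken : ∀ {n K} → BoundedPartition n K → BoundedPartition n (suc K)
weaken (μ , bound) = μ , λ j → ℕ.m<n⇒m<1+n (bound j)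

-- A Pascal-type recursion: the largest exponent either equals `K` or is smaller. The bounds stay
-- attached because `prepend` requires them.
bounded : ∀ n K → List (BoundedPartition n K)
bounded zero    K       = (partition [] [] , λ ()) ∷ []
bounded (suc n) zero    = []
bounded (suc n) (suc K) = map prependᵇ (bounded n K) ++ map weaken (bounded (suc n) K)

boundedPartitions : ∀ n K → List (Partition n)
boundedPartitions n K = map proj₁ (bounded n K)

prepend-injective : ∀ {n K} (μ ν : BoundedPartition n K) → prepend μ ≡ prepend ν → proj₁ μ ≡ proj₁ ν
prepend-injective μ ν eq with ≡.refl ← ≡.cong (Vec.tail ∘ Partition.parts) eq = ≡.refl

boundedPartitions-unique : ∀ n K → Unique (boundedPartitions n K)
boundedPartitions-unique n K = AllPairs.map⁺ (distinct n K)
  where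
  distinct : ∀ n K → AllPairs (λ μ ν → proj₁ μ ≢ proj₁ ν) (bounded n K)
  distinct zero    K       = All.[] ∷ []
  distinct (suc n) zero    = []
  distinct (suc n) (suc K) = AllPairs.++⁺
    (AllPairs.map⁺ (AllPairs.map (λ {μ} {ν} μ≢ν → μ≢ν ∘ prepend-injective μ ν) (distinct n K)))
    (AllPairs.map⁺ (distinct (suc n) K))
    -- The two halves are disjoint: the first exponent is `K` in one and below `K` in the other.
    (All.map⁺ (All.universal (λ μ → All.map⁺ (All.universal (λ ν eq →
      ℕ.<-irrefl (≡.trans (≡.cong (λ μ → exponent μ zero) (≡.sym eq)) (exponent-prepend-zero μ))
                 (proj₂ ν zero)) (bounded (suc n) K))) (bounded n K)))

-- The first exponent is the largest, so comparing it with `K` decides in which half of `bounded` to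
-- search. Only first components are equated, since the bounds are functions.
bounded-complete : ∀ {n} K (μ : Partition n) → (∀ j → exponent μ j < K) →
                   Σ[ ν ∈ BoundedPartition n K ] Σ[ _ ∈ ν ∈ bounded n K ] proj₁ ν ≡ μ
bounded-complete {zero}  K       (partition [] d) bound = _ , here ≡.refl , ≡.refl
bounded-complete {suc n} zero    μ bound = contradiction (bound zero) ℕ.n≮0
bounded-complete {suc n} (suc K) μ bound with exponent μ zero ℕ.≟ K
... | no  e≢K
  with e<K ← ℕ.≤∧≢⇒< (ℕ.≤-pred (bound zero)) e≢K
  with ν , ν∈ , eq ← bounded-complete K μ
         (λ { zero → e<K ; (suc j) → ℕ.<-trans (exponent-decreasing μ j) e<K })
  = _ , ∈-++⁺ʳ (map prependᵇ (bounded n K)) (∈-map⁺ weaken ν∈) , eq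
bounded-complete {suc n} (suc K) μ@(partition (p ∷ ps) d) bound | yes e≡K
  with ν , ν∈ , ≡.refl ← bounded-complete K (partition ps (Linked.tail d))
         (λ j → ≡.subst (exponent μ (suc j) <_) e≡K (exponent-decreasing μ j))
  = _ , ∈-++⁺ˡ (∈-map⁺ prependᵇ ν∈) ,
    -- With exponent `K` the first part `p` is the prepended `K ∸ n`; irrelevance of `decreasing`
    -- makes this equation sufficient.
    first (≡.trans (≡.cong (_∸ n) (≡.sym e≡K)) (ℕ.m+n∸n≡m p n))
  where
  first : ∀ {q} .{e} → q ≡ p → partition (q ∷ ps) e ≡ μ
  first ≡.refl = ≡.refl

∈-boundedPartitions : ∀ {n} K (μ : Partition n) → (∀ j → exponent μ j < K) → μ ∈ boundedPartitions n K
∈-boundedPartitions K μ bound with ν , ν∈ , eq ← bounded-complete K μ bound =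
  ≡.subst (_∈ _) eq (∈-map⁺ proj₁ ν∈)

-- Determinant expansions and rank one updates.

module Determinants {c ℓ} (A : CommutativeRing c ℓ) where

  open RingTheory A
  open RowReduction using (dbl; dbl-self; dbl-swap)
  open SetoidReasoning setoid
  open SemiringSolver commutativeSemiring using (solve; _:=_; _:+_; _:*_; con)

  sum-exchange : ∀ m n (a : Fin m → Carrier) (b : Fin n → Carrier) (E : Fin m → Fin n → Carrier) →
    ∑[ j < m ] (a j * ∑[ i < n ] (b i * E j i)) ≈ ∑[ i < n ] (b i * ∑[ j < m ] (a j * E j i))
  sum-exchange m n a b E = begin
    ∑[ j < m ] (a j * ∑[ i < n ] (b i * E j i))
      ≈⟨ sum-cong m (λ j → *-distribˡ-sum (a j) (λ i → b i * E j i)) ⟩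
    ∑[ j < m ] ∑[ i < n ] (a j * (b i * E j i))
      ≈⟨ ∑-comm (λ j i → a j * (b i * E j i)) ⟩
    ∑[ i < n ] ∑[ j < m ] (a j * (b i * E j i))
      ≈⟨ sum-cong n (λ i → sum-cong m λ j →
           solve 3 (λ p q r → p :* (q :* r) := q :* (p :* r)) refl (a j) (b i) (E j i)) ⟩
    ∑[ i < n ] ∑[ j < m ] (b i * (a j * E j i))
      ≈⟨ sum-cong n (λ i → *-distribˡ-sum (b i) (λ j → a j * E j i)) ⟨
    ∑[ i < n ] (b i * ∑[ j < m ] (a j * E j i)) ∎

  -- Expand along the first row, then by induction expand every minor but the first along its first
  -- column, and exchange the two sums. This matches `prepend`, which adds a first column to an
  -- alternant.
  det-first-column : ∀ n (M : Fin (suc n) → Fin (suc n) → Carrier) →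
    det M ≈ ∑[ i ≤ n ] (sign i * M i zero * det (λ k l → M (punchIn i k) (suc l)))
  det-first-column zero    M = refl
  det-first-column (suc n) M = +-congˡ (begin
    ∑[ j ≤ n ] (- 1# * sign j * M zero (suc j) * det (λ i k → M (suc i) (punchIn (suc j) k)))
      ≈⟨ sum-cong (suc n) (λ j → *-cong (*-assoc (- 1#) (sign j) (M zero (suc j)))
           (det-first-column n (λ i k → M (suc i) (punchIn (suc j) k)))) ⟩
    ∑[ j ≤ n ] (- 1# * (sign j * M zero (suc j)) * ∑[ i ≤ n ] (sign i * M (suc i) zero * E j i))
      ≈⟨ sum-cong (suc n) (λ j → *-assoc (- 1#) (sign j * M zero (suc j))
           (∑[ i ≤ n ] (sign i * M (suc i) zero * E j i))) ⟩
    ∑[ j ≤ n ] (- 1# * (sign j * M zero (suc j) * ∑[ i ≤ n ] (sign i * M (suc i) zero * E j i)))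
      ≈⟨ *-distribˡ-sum (- 1#) (λ j → sign j * M zero (suc j) * ∑[ i ≤ n ] (sign i * M (suc i) zero * E j i)) ⟨
    - 1# * ∑[ j ≤ n ] (sign j * M zero (suc j) * ∑[ i ≤ n ] (sign i * M (suc i) zero * E j i))
      ≈⟨ *-congˡ (sum-exchange (suc n) (suc n) (λ j → sign j * M zero (suc j)) (λ i → sign i * M (suc i) zero) E) ⟩
    - 1# * ∑[ i ≤ n ] (sign i * M (suc i) zero * ∑[ j ≤ n ] (sign j * M zero (suc j) * E j i))
      ≈⟨ *-distribˡ-sum (- 1#) (λ i → sign i * M (suc i) zero * ∑[ j ≤ n ] (sign j * M zero (suc j) * E j i)) ⟩
    ∑[ i ≤ n ] (- 1# * (sign i * M (suc i) zero * ∑[ j ≤ n ] (sign j * M zero (suc j) * E j i)))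
      ≈⟨ sum-cong (suc n) (λ i → solve 4 (λ p q r s → p :* (q :* r :* s) := p :* q :* r :* s) refl
           (- 1#) (sign i) (M (suc i) zero) (∑[ j ≤ n ] (sign j * M zero (suc j) * E j i))) ⟩
    ∑[ i ≤ n ] (- 1# * sign i * M (suc i) zero * det (λ k l → M (punchIn (suc i) k) (suc l))) ∎)
    where
    E : Fin (suc n) → Fin (suc n) → Carrier
    E j i = det (λ k l → M (suc (punchIn i k)) (suc (punchIn j l)))

  -- The part of det (M + u vᵀ) that is linear in u vᵀ; there is no quadratic part, as two rows of it
  -- would be proportional.

  cofactorSum : ∀ {n} (u v : Fin (suc n) → Carrier) (M : Fin (suc n) → Fin (suc n) → Carrier) → Carrier
  cofactorSum {n} u v M =
    ∑[ i ≤ n ] (sign i * u i * ∑[ j ≤ n ] (sign j * v j * det (λ k l → M (punchIn i k) (punchIn j l))))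

  -- Induction along the first row: `M zero j + u zero * v j` meets a minor `D j + R j`, with `R j`
  -- its linear part. The four products give `det M`, the summand `i = zero` of `cofactorSum`, its
  -- other summands, and a vanishing quadratic part.
  det-rank-one : ∀ n (u v : Fin (suc n) → Carrier) (M : Fin (suc n) → Fin (suc n) → Carrier) →
    det (λ i j → M i j + u i * v j) ≈ det M + cofactorSum u v M
  det-rank-one zero u v M =
    solve 3 (λ m p q → con 1 :* (m :+ p :* q) :* con 1 :+ con 0 :=
                       (con 1 :* m :* con 1 :+ con 0) :+
                       (con 1 :* p :* (con 1 :* q :* con 1 :+ con 0) :+ con 0))
      refl (M zero zero) (u zero) (v zero)
  det-rank-one (suc n) u v M = begin
    ∑[ j ≤ suc n ] (sign j * (M zero j + u zero * v j) *
                    det (λ i k → M (suc i) (punchIn j k) + u (suc i) * v (punchIn j k)))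
      ≈⟨ sum-cong (2 ℕ.+ n) (λ j → trans
           (*-congˡ {x = sign j * (M zero j + u zero * v j)}
             (det-rank-one n (u ∘ suc) (v ∘ punchIn j) (λ i k → M (suc i) (punchIn j k))))
           (solve 6 (λ s m p q d r →
             s :* (m :+ p :* q) :* (d :+ r) :=
             (s :* m :* d :+ (con 1 :* p) :* (s :* q :* d)) :+ (s :* m :* r :+ p :* (s :* q :* r))) refl
             (sign j) (M zero j) (u zero) (v j) (D j) (R j))) ⟩
    ∑[ j ≤ suc n ] (sign j * M zero j * D j + 1# * u zero * (sign j * v j * D j) +
                    (sign j * M zero j * R j + u zero * (sign j * v j * R j)))
      ≈⟨ trans (∑-distrib-+ (λ j → sign j * M zero j * D j + 1# * u zero * (sign j * v j * D j))
                            (λ j → sign j * M zero j * R j + u zero * (sign j * v j * R j)))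
         (+-cong (∑-distrib-+ (λ j → sign j * M zero j * D j) (λ j → 1# * u zero * (sign j * v j * D j)))
                 (∑-distrib-+ (λ j → sign j * M zero j * R j) (λ j → u zero * (sign j * v j * R j)))) ⟩
    (det M + ∑[ j ≤ suc n ] (1# * u zero * (sign j * v j * D j))) +
    (∑[ j ≤ suc n ] (sign j * M zero j * R j) + ∑[ j ≤ suc n ] (u zero * (sign j * v j * R j)))
      ≈⟨ +-cong (+-congˡ (sym (*-distribˡ-sum (1# * u zero) (λ j → sign j * v j * D j))))
                (+-cong crossTerm (trans (sym (*-distribˡ-sum (u zero) (λ j → sign j * v j * R j)))
                                         (trans (*-congˡ quadraticTerm) (zeroʳ (u zero))))) ⟩
    (det M + 1# * u zero * ∑[ j ≤ suc n ] (sign j * v j * D j)) +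
    (∑[ i ≤ n ] (- 1# * sign i * u (suc i) * dbl v (M zero) (E i)) + 0#)
      ≈⟨ trans (+-congˡ (+-identityʳ _)) (+-assoc _ _ _) ⟩
    det M + cofactorSum u v M ∎
    where
    D : Fin (2 ℕ.+ n) → Carrier
    D j = det (λ i k → M (suc i) (punchIn j k))
    E : Fin (suc n) → (Fin n → Fin (2 ℕ.+ n)) → Carrier
    E i f = det (λ k p → M (suc (punchIn i k)) (f p))
    E-ext : ∀ i {f g} → (∀ k → f k ≡ g k) → E i f ≈ E i g
    E-ext i f≗g = det-cong λ k p → reflexive (≡.cong (M (suc (punchIn i k))) (f≗g p))
    R : Fin (2 ℕ.+ n) → Carrier
    R j = cofactorSum (u ∘ suc) (v ∘ punchIn j) (λ i k → M (suc i) (punchIn j k))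
    -- Moving the sum over rows outside leaves a double Laplace expansion with top rows `w` and `v`,
    -- which is `dbl`.
    regroup : ∀ w → ∑[ j ≤ suc n ] (sign j * w j * R j) ≈ ∑[ i ≤ n ] (sign i * u (suc i) * dbl w v (E i))
    regroup w = sum-exchange (2 ℕ.+ n) (suc n) (λ j → sign j * w j) (λ i → sign i * u (suc i))
      (λ j i → ∑[ l ≤ n ] (sign l * v (punchIn j l) * E i (λ k → punchIn j (punchIn l k))))
    quadraticTerm : ∑[ j ≤ suc n ] (sign j * v j * R j) ≈ 0#
    quadraticTerm = trans (regroup v) (sum-0 (suc n) λ i →
      trans (*-congˡ (dbl-self v (E i) (E-ext i))) (zeroʳ (sign i * u (suc i))))
    -- In `cofactorSum` the row `v` comes above `M zero`; exchanging them yields the extra `- 1#` of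
    -- `sign (suc i)`.
    crossTerm : ∑[ j ≤ suc n ] (sign j * M zero j * R j) ≈
                ∑[ i ≤ n ] (- 1# * sign i * u (suc i) * dbl v (M zero) (E i))
    crossTerm = trans (regroup (M zero)) (sum-cong (suc n) λ i → begin
      sign i * u (suc i) * dbl (M zero) v (E i)
        ≈⟨ *-congˡ (dbl-swap (M zero) v (E i) (E-ext i)) ⟩
      sign i * u (suc i) * - dbl v (M zero) (E i)
        ≈⟨ -‿distribʳ-* _ _ ⟨
      - (sign i * u (suc i) * dbl v (M zero) (E i))
        ≈⟨ RowReduction.neg-sign i (u (suc i)) (dbl v (M zero) (E i)) ⟨
      - 1# * sign i * u (suc i) * dbl v (M zero) (E i) ∎)

  -- The form in which `HasSum` writes its finite partial sums.
  listSum : List Carrier → Carrier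
  listSum = foldr _+_ 0#

  listSum-++ : ∀ as bs → listSum (as ++ bs) ≈ listSum as + listSum bs
  listSum-++ []       bs = sym (+-identityˡ _)
  listSum-++ (a ∷ as) bs = trans (+-congˡ (listSum-++ as bs)) (sym (+-assoc _ _ _))

  listSum-map-cong : ∀ {I : Set} {f g : I → Carrier} → (∀ i → f i ≈ g i) → ∀ is →
    listSum (map f is) ≈ listSum (map g is)
  listSum-map-cong f≈g []       = refl
  listSum-map-cong f≈g (i ∷ is) = +-cong (f≈g i) (listSum-map-cong f≈g is)

  *-distribʳ-listSum : ∀ {I : Set} a (f : I → Carrier) is →
    listSum (map f is) * a ≈ listSum (map (λ i → f i * a) is)
  *-distribʳ-listSum a f []       = zeroˡ a
  *-distribʳ-listSum a f (i ∷ is) = trans (distribʳ _ _ _) (+-congˡ (*-distribʳ-listSum a f is))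

  *-distribˡ-listSum : ∀ {I : Set} a (f : I → Carrier) is →
    a * listSum (map f is) ≈ listSum (map (λ i → a * f i) is)
  *-distribˡ-listSum a f []       = zeroʳ a
  *-distribˡ-listSum a f (i ∷ is) = trans (distribˡ _ _ _) (+-congˡ (*-distribˡ-listSum a f is))

  sum-listSum-comm : ∀ {I : Set} n (f : Fin n → I → Carrier) is →
    ∑[ j < n ] (listSum (map (f j) is)) ≈ listSum (map (λ i → ∑[ j < n ] f j i) is)
  sum-listSum-comm n f []       = sum-0 n λ _ → refl
  sum-listSum-comm n f (i ∷ is) = trans
    (∑-distrib-+ (λ j → f j i) (λ j → listSum (map (f j) is)))
    (+-congˡ (sum-listSum-comm n f is))

  -- The Cauchy-Binet formula, indexed by partitions.

  below : (ℕ → Carrier) → ℕ → Carrier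
  below f zero    = 0#
  below f (suc K) = below f K + f K

  -- A partition stands for the `n`-element set of its exponents; the two determinants are the
  -- maximal minors on that set.
  cauchyBinetTerm : ∀ {n} (c : ℕ → Carrier) (a b : ℕ → Fin n → Carrier) → Partition n → Carrier
  cauchyBinetTerm {n} c a b μ =
    (∏[ j < n ] c (exponent μ j)) *
    (det (λ i j → a (exponent μ j) i) * det (λ i j → b (exponent μ j) i))

  -- The statement must hold for all `n`, `a` and `b` at once: the minors in the rank one correction
  -- are of the same form, with one index deleted from `a` and one from `b`.
  cauchyBinet : ∀ {n} K (c : ℕ → Carrier) (a b : ℕ → Fin n → Carrier) →
    det (λ i j → below (λ k → c k * (a k i * b k j)) K) ≈
    listSum (map (cauchyBinetTerm c a b) (boundedPartitions n K))
  cauchyBinet {zero}  K       c a b =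
    solve 0 (con 1 := con 1 :* (con 1 :* con 1) :+ con 0) refl
  cauchyBinet {suc n} zero    c a b = sum-0 (suc n) λ j → 
    trans (*-congʳ {x = det {n} λ _ _ → 0#} (zeroʳ (sign j))) (zeroˡ (det {n} λ _ _ → 0#))
  cauchyBinet {suc n} (suc K) c a b = begin
    det (λ i j → M i j + c K * (a K i * b K j))
      ≈⟨ det-cong (λ i j → +-congˡ {x = M i j} (sym (*-assoc (c K) (a K i) (b K j)))) ⟩
    det (λ i j → M i j + (c K * a K i) * b K j)
      ≈⟨ det-rank-one n (λ i → c K * a K i) (b K) M ⟩
    det M + cofactorSum (λ i → c K * a K i) (b K) M
      ≈⟨ +-comm _ _ ⟩
    cofactorSum (λ i → c K * a K i) (b K) M + det M
      ≈⟨ +-cong leading (cauchyBinet K c a b) ⟩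
    listSum (map (T ∘ prepend) (bounded n K)) + listSum (map T (map proj₁ (bounded (suc n) K)))
      ≈⟨ listSum-++ (map (T ∘ prepend) (bounded n K)) _ ⟨
    listSum (map (T ∘ prepend) (bounded n K) ++ map T (map proj₁ (bounded (suc n) K)))
      ≡⟨ ≡.cong listSum lists ⟨
    listSum (map T (boundedPartitions (suc n) (suc K))) ∎
    where
    M : Fin (suc n) → Fin (suc n) → Carrier
    M i j = below (λ k → c k * (a k i * b k j)) K
    T : Partition (suc n) → Carrier
    T = cauchyBinetTerm c a b
    lists : map T (boundedPartitions (suc n) (suc K)) ≡
            map (T ∘ prepend) (bounded n K) ++ map T (map proj₁ (bounded (suc n) K))
    lists = ≡.trans (≡.sym (map-∘ (map prependᵇ (bounded n K) ++ map weaken (bounded (suc n) K))))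
           (≡.trans (map-++ (T ∘ proj₁) (map prependᵇ (bounded n K)) _)
           (≡.cong₂ _++_ (≡.sym (map-∘ (bounded n K)))
                         (≡.trans (≡.sym (map-∘ (bounded (suc n) K))) (map-∘ (bounded (suc n) K)))))
    C : BoundedPartition n K → Carrier
    C μ = ∏[ j < n ] c (exponent (proj₁ μ) j)
    α β : BoundedPartition n K → Fin (suc n) → Carrier
    α μ i = det (λ k l → a (exponent (proj₁ μ) l) (punchIn i k))
    β μ j = det (λ k l → b (exponent (proj₁ μ) l) (punchIn j k))
    p q : Fin (suc n) → Carrier
    p i = sign i * (c K * a K i)
    q j = sign j * b K j
    expand : ∀ (d : ℕ → Fin (suc n) → Carrier) (μ : BoundedPartition n K) →
      det (λ i j → d (exponent (prepend μ) j) i) ≈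
      ∑[ i ≤ n ] (sign i * d K i * det (λ k l → d (exponent (proj₁ μ) l) (punchIn i k)))
    expand d μ = trans (det-first-column n (λ i j → d (exponent (prepend μ) j) i))
      (sum-cong (suc n) λ i → *-congʳ {x = det (λ k l → d (exponent (proj₁ μ) l) (punchIn i k))} (*-congˡ {x = sign i}
        (reflexive (≡.cong (λ k → d k i) (exponent-prepend-zero μ)))))
    -- For fixed `μ` the double sum factors into the first-column expansions of the two alternants
    -- of `prepend μ`.
    single : ∀ μ → ∑[ i ≤ n ] (p i * ∑[ j ≤ n ] (q j * (C μ * (α μ i * β μ j)))) ≈ T (prepend μ)
    single μ = begin
      ∑[ i ≤ n ] (p i * ∑[ j ≤ n ] (q j * (C μ * (α μ i * β μ j))))
        ≈⟨ sum-cong (suc n) (λ i → *-congˡ {x = p i} (trans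
             (sum-cong (suc n) λ j →
               solve 4 (λ x y z w → x :* (y :* (z :* w)) := (y :* z) :* (x :* w)) refl
                 (q j) (C μ) (α μ i) (β μ j))
             (sym (*-distribˡ-sum (C μ * α μ i) (λ j → q j * β μ j))))) ⟩
      ∑[ i ≤ n ] (p i * (C μ * α μ i * B))
        ≈⟨ sum-cong (suc n) (λ i →
             solve 6 (λ s k x y z w → s :* (k :* x) :* (y :* z :* w) := (s :* x :* z) :* (k :* y :* w)) refl
               (sign i) (c K) (a K i) (C μ) (α μ i) B) ⟩
      ∑[ i ≤ n ] (sign i * a K i * α μ i * (c K * C μ * B))
        ≈⟨ *-distribʳ-sum (c K * C μ * B) (λ i → sign i * a K i * α μ i) ⟨
      ∑[ i ≤ n ] (sign i * a K i * α μ i) * (c K * C μ * B)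
        ≈⟨ solve 3 (λ x y z → x :* (y :* z) := y :* (x :* z)) refl
             (∑[ i ≤ n ] (sign i * a K i * α μ i)) (c K * C μ) B ⟩
      c K * C μ * (∑[ i ≤ n ] (sign i * a K i * α μ i) * B)
        ≈⟨ *-cong (*-congʳ (reflexive (≡.cong c (exponent-prepend-zero μ))))
                  (*-cong (expand a μ) (expand b μ)) ⟨
      T (prepend μ) ∎
      where
      B : Carrier
      B = ∑[ j ≤ n ] (q j * β μ j)
    leading : cofactorSum (λ i → c K * a K i) (b K) M ≈ listSum (map (T ∘ prepend) (bounded n K))
    leading = begin
      ∑[ i ≤ n ] (p i * ∑[ j ≤ n ] (q j * det (λ k l → M (punchIn i k) (punchIn j l))))
        -- The induction hypothesis in size `n`, with row `i` and column `j` deleted.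
        ≈⟨ sum-cong (suc n) (λ i → *-congˡ {x = p i} (sum-cong (suc n) λ j → *-congˡ {x = q j} (trans
             (cauchyBinet K c (λ k → a k ∘ punchIn i) (λ k → b k ∘ punchIn j))
             (reflexive (≡.cong listSum (≡.sym (map-∘ (bounded n K)))))))) ⟩
      ∑[ i ≤ n ] (p i * ∑[ j ≤ n ] (q j * listSum (map (λ μ → C μ * (α μ i * β μ j)) (bounded n K))))
        ≈⟨ sum-cong (suc n) (λ i → *-congˡ {x = p i} (linear q (λ j μ → C μ * (α μ i * β μ j)))) ⟩
      ∑[ i ≤ n ] (p i * listSum (map (λ μ → ∑[ j ≤ n ] (q j * (C μ * (α μ i * β μ j)))) (bounded n K)))
        ≈⟨ linear p (λ i μ → ∑[ j ≤ n ] (q j * (C μ * (α μ i * β μ j)))) ⟩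
      listSum (map (λ μ → ∑[ i ≤ n ] (p i * ∑[ j ≤ n ] (q j * (C μ * (α μ i * β μ j))))) (bounded n K))
        ≈⟨ listSum-map-cong single (bounded n K) ⟩
      listSum (map (T ∘ prepend) (bounded n K)) ∎
      where
      linear : ∀ (r : Fin (suc n) → Carrier) (f : Fin (suc n) → BoundedPartition n K → Carrier) →
        ∑[ i ≤ n ] (r i * listSum (map (f i) (bounded n K))) ≈
        listSum (map (λ μ → ∑[ i ≤ n ] (r i * f i μ)) (bounded n K))
      linear r f = trans
        (sum-cong (suc n) λ i → *-distribˡ-listSum (r i) (f i) (bounded n K))
        (sum-listSum-comm (suc n) (λ i μ → r i * f i μ) (bounded n K))

-- Order of vanishing, congruence up to an order, and division.

module Orders {c ℓ} (R : CommutativeRing c ℓ) (m : ℕ) where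

  private module R = RingTheory R
  open MultivariateSeries R
  open RingTheory (R ⟦ m ⟧)
  open Determinants (R ⟦ m ⟧) using (listSum)
  open SetoidReasoning setoid
  private
    module + = CommutativeSemigroupProperties
                 (CommutativeMonoid.commutativeSemigroup +-commutativeMonoid)

  order-resp : ∀ N f g → f ≈ g → Order≥ m N f → Order≥ m N g
  order-resp N f g f≈g of a a<N = R.trans (R.sym (coeff-cong a f≈g)) (of a a<N)

  order-weaken : ∀ {M N} f → M ≤ N → Order≥ m N f → Order≥ m M f
  order-weaken f M≤N of a a<M = of a (ℕ.<-≤-trans a<M M≤N)

  order-0 : ∀ N → Order≥ m N 0#
  order-0 N a _ = coeff-0 a

  order-*ʳ : ∀ N f g → Order≥ m N g → Order≥ m N (f * g)
  order-*ʳ N f g = order-* m 0 N f g (λ _ ())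

  order-*ˡ : ∀ N f g → Order≥ m N f → Order≥ m N (f * g)
  order-*ˡ N f g of = order-resp N (g * f) (f * g) (*-comm g f) (order-*ʳ N g f of)

  order-sum : ∀ N n (f : Fin n → Carrier) → (∀ i → Order≥ m N (f i)) → Order≥ m N (sum f)
  order-sum N zero    f of = order-0 N
  order-sum N (suc n) f of =
    order-+ m N (f zero) (sum (f ∘ suc)) (of zero) (order-sum N n (f ∘ suc) (of ∘ suc))

  order-∞ : ∀ f → (∀ N → Order≥ m N f) → f ≈ 0#
  order-∞ f of = coeff-ext m λ a → R.trans (of (suc (Vec.sum a)) a ℕ.≤-refl) (R.sym (coeff-0 a))

  -- Every summand of the first-row expansion contains an entry of column `j`: the first-row entry
  -- if `l` is `j`, otherwise one inside the minor, where that column has index `punchOut l≢j`.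
  order-det-column : ∀ N n (M : Fin n → Fin n → Carrier) j → (∀ i → Order≥ m N (M i j)) →
                     Order≥ m N (det M)
  order-det-column N (suc n) M j oM = order-sum N (suc n) _ term
    where
    minor : Fin (suc n) → Fin n → Fin n → Carrier
    minor l i k = M (suc i) (punchIn l k)
    term : ∀ l → Order≥ m N (sign l * M zero l * det (minor l))
    term l with l Fin.≟ j
    ... | yes ≡.refl = order-*ˡ N (sign l * M zero l) (det (minor l)) (order-*ʳ N (sign l) (M zero l) (oM zero))
    ... | no  l≢j    = order-*ʳ N (sign l * M zero l) (det (minor l))
      (order-det-column N n (minor l) (punchOut l≢j) λ i →
        ≡.subst (λ k → Order≥ m N (M (suc i) k)) (≡.sym (punchIn-punchOut l≢j)) (oM (suc i)))

  -- Congruence modulo the ideal of series of order at least `N`.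
  Agree : ℕ → Carrier → Carrier → Set ℓ
  Agree N f g = Order≥ m N (f - g)

  agree-reflexive : ∀ N f g → f ≈ g → Agree N f g
  agree-reflexive N f g f≈g = order-resp N 0# (f - g)
    (sym (trans (+-congˡ (-‿cong (sym f≈g))) (-‿inverseʳ f))) (order-0 N)

  agree-trans : ∀ N f g h → Agree N f g → Agree N g h → Agree N f h
  agree-trans N f g h fg gh = order-resp N ((f - g) + (g - h)) (f - h)
    (trans (sym (+-assoc _ _ _)) (+-congʳ (a-b+b≈a f g)))
    (order-+ m N (f - g) (g - h) fg gh)

  agree-sym : ∀ N f g → Agree N f g → Agree N g f
  agree-sym N f g fg = order-resp N (- (f - g)) (g - f)
    (trans (sym (-‿+-comm f (- g))) (trans (+-congˡ (-‿involutive g)) (+-comm _ _)))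
    (order-neg m N (f - g) fg)

  agree-+ : ∀ N f f′ g g′ → Agree N f f′ → Agree N g g′ → Agree N (f + g) (f′ + g′)
  agree-+ N f f′ g g′ of og = order-resp N ((f - f′) + (g - g′)) ((f + g) - (f′ + g′))
    (begin
      (f - f′) + (g - g′)      ≈⟨ +.interchange f (- f′) g (- g′) ⟩
      (f + g) + (- f′ + - g′)  ≈⟨ +-congˡ (-‿+-comm f′ g′) ⟩
      (f + g) - (f′ + g′)      ∎)
    (order-+ m N (f - f′) (g - g′) of og)

  agree-neg : ∀ N f g → Agree N f g → Agree N (- f) (- g)
  agree-neg N f g fg = order-resp N (- (f - g)) (- f - - g) (sym (-‿+-comm f (- g)))
    (order-neg m N (f - g) fg)

  agree-*ʳ : ∀ N f f′ g → Agree N f f′ → Agree N (f * g) (f′ * g)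
  agree-*ʳ N f f′ g of = order-resp N ((f - f′) * g) (f * g - f′ * g)
    ([y-z]x≈yx-zx g f f′) (order-*ˡ N (f - f′) g of)

  agree-* : ∀ N f f′ g g′ → Agree N f f′ → Agree N g g′ → Agree N (f * g) (f′ * g′)
  agree-* N f f′ g g′ of og = agree-trans N (f * g) (f′ * g) (f′ * g′) (agree-*ʳ N f f′ g of)
    (agree-trans N (f′ * g) (g * f′) (f′ * g′) (agree-reflexive N (f′ * g) (g * f′) (*-comm f′ g))
    (agree-trans N (g * f′) (g′ * f′) (f′ * g′) (agree-*ʳ N g g′ f′ og)
    (agree-reflexive N (g′ * f′) (f′ * g′) (*-comm g′ f′))))

  agree-sum : ∀ N n (f g : Fin n → Carrier) → (∀ i → Agree N (f i) (g i)) → Agree N (sum f) (sum g)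
  agree-sum N zero    f g fg = agree-reflexive N 0# 0# refl
  agree-sum N (suc n) f g fg = agree-+ N (f zero) (g zero) (sum (f ∘ suc)) (sum (g ∘ suc))
    (fg zero) (agree-sum N n (f ∘ suc) (g ∘ suc) (fg ∘ suc))

  agree-det : ∀ N n (M M′ : Fin n → Fin n → Carrier) → (∀ i j → Agree N (M i j) (M′ i j)) →
              Agree N (det M) (det M′)
  agree-det N zero    M M′ MM′ = agree-reflexive N 1# 1# refl
  agree-det N (suc n) M M′ MM′ = agree-sum N (suc n) _ _ λ j →
    agree-* N (sign j * M zero j) (sign j * M′ zero j)
              (det λ i k → M (suc i) (punchIn j k)) (det λ i k → M′ (suc i) (punchIn j k))
      (agree-* N (sign j) (sign j) (M zero j) (M′ zero j)
        (agree-reflexive N (sign j) (sign j) refl) (MM′ zero j))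
      (agree-det N n _ _ λ i k → MM′ (suc i) (punchIn j k))

  -- Division by g lowers the order by at most d.

  CancelsOrder : ℕ → Carrier → Set (c ⊔ ℓ)
  CancelsOrder d g = ∀ N q → Order≥ m (d ℕ.+ N) (q * g) → Order≥ m N q

  cancels-resp : ∀ d g h → g ≈ h → CancelsOrder d g → CancelsOrder d h
  cancels-resp d g h g≈h cg N q o =
    cg N q (order-resp (d ℕ.+ N) (q * h) (q * g) (*-congˡ (sym g≈h)) o)

  cancels-1 : CancelsOrder 0 1#
  cancels-1 N q = order-resp N (q * 1#) q (*-identityʳ q)

  cancels-neg : ∀ d g → CancelsOrder d g → CancelsOrder d (- g)
  cancels-neg d g cg N q o = cg N q (order-resp (d ℕ.+ N) (- (q * - g)) (q * g)
    (trans (-‿cong (sym (-‿distribʳ-* q g))) (-‿involutive _))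
    (order-neg m (d ℕ.+ N) (q * - g) o))

  cancels-* : ∀ d e g h → CancelsOrder d g → CancelsOrder e h → CancelsOrder (d ℕ.+ e) (g * h)
  -- `h` is cancelled first, at the cost `e`, leaving order `d + N` for `g`.
  cancels-* d e g h cg ch N q o = cg N q (ch (d ℕ.+ N) (q * g)
    (≡.subst (λ k → Order≥ m k (q * g * h)) (≡.trans (≡.cong (ℕ._+ N) (ℕ.+-comm d e)) (ℕ.+-assoc e d N))
      (order-resp (d ℕ.+ e ℕ.+ N) (q * (g * h)) (q * g * h) (sym (*-assoc q g h)) o)))

  cancels-∏ : ∀ n (f : Fin n → Carrier) → (∀ i → ∃[ d ] CancelsOrder d (f i)) →
              ∃[ d ] CancelsOrder d (∏[ i < n ] f i)
  cancels-∏ zero    f cf = 0 , cancels-1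
  cancels-∏ (suc n) f cf
    with d , cd ← cf zero
    with e , ce ← cancels-∏ n (f ∘ suc) (cf ∘ suc)
    = d ℕ.+ e , cancels-* d e (f zero) _ cd ce

  -- Enlarging a finite partial sum.

  listSum-↭ : ∀ {I : Set} (f : I → Carrier) {is js} → is ↭ js → listSum (map f is) ≈ listSum (map f js)
  listSum-↭ f ↭.refl         = refl
  listSum-↭ f (↭.prep i p)   = +-congˡ (listSum-↭ f p)
  listSum-↭ f (↭.swap i j p) = trans (+-congˡ (+-congˡ (listSum-↭ f p)))
    (trans (sym (+-assoc _ _ _)) (trans (+-congʳ (+-comm (f i) (f j))) (+-assoc _ _ _)))
  listSum-↭ f (↭.trans p q)  = trans (listSum-↭ f p) (listSum-↭ f q)

  -- Each element of `F` is moved to the front of `G` by a permutation and removed from both lists.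
  -- Uniqueness leaves no second copy, so when `F` is used up only summands of order at least `N`
  -- remain.
  agree-superset : ∀ {I : Set} N (f : I → Carrier) F G → Unique F → Unique G → F ⊆ G →
    (∀ {i} → i ∈ G → i ∈ F ⊎ Order≥ m N (f i)) →
    Agree N (listSum (map f G)) (listSum (map f F))
  agree-superset N f [] G uF uG F⊆G rest = order-resp N (listSum (map f G)) (listSum (map f G) - 0#)
    (sym (trans (+-congˡ -0#≈0#) (+-identityʳ _))) (small G rest)
    where
    small : ∀ G → (∀ {i} → i ∈ G → i ∈ [] ⊎ Order≥ m N (f i)) → Order≥ m N (listSum (map f G))
    small []      rest = order-0 N
    small (g ∷ G) rest with inj₂ o ← rest (here ≡.refl) =
      order-+ m N (f g) (listSum (map f G)) o (small G (rest ∘ there))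
  agree-superset {I} N f (x ∷ F) G (x∉F ∷ uF) uG F⊆G rest
    with ys , zs , ≡.refl ← ∈-∃++ (F⊆G (here ≡.refl))
    with x∉G′ ∷ uG′ ← PermutationSetoid.Unique-resp-↭ (≡.setoid I) (↭.↭⇒↭ₛ (shift x ys zs)) uG
    = agree-trans N (listSum (map f (ys ++ x ∷ zs))) (f x + listSum (map f (ys ++ zs))) (f x + listSum (map f F))
        (agree-reflexive N _ _ (listSum-↭ f (shift x ys zs)))
        (agree-+ N (f x) (f x) (listSum (map f (ys ++ zs))) (listSum (map f F))
          (agree-reflexive N (f x) (f x) refl)
          (agree-superset N f F (ys ++ zs) uF uG′ F⊆G′ rest′))
    where
    F⊆G′ : F ⊆ (ys ++ zs)
    F⊆G′ i∈F with ∈-resp-↭ (shift x ys zs) (F⊆G (there i∈F))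
    ... | here ≡.refl = contradiction ≡.refl (All.lookup x∉F i∈F)
    ... | there i∈G′  = i∈G′
    rest′ : ∀ {i} → i ∈ ys ++ zs → i ∈ F ⊎ Order≥ m N (f i)
    rest′ i∈G′ with rest (∈-resp-↭ (↭.↭-sym (shift x ys zs)) (there i∈G′))
    ... | inj₁ (here ≡.refl) = contradiction ≡.refl (All.lookup x∉G′ i∈G′)
    ... | inj₁ (there i∈F)   = inj₁ i∈F
    ... | inj₂ o             = inj₂ o

  -- Convergence of the truncated sums after division by `D`.

  module Summation
    {I : Set} (f : I → Carrier) (D T : Carrier) (d : ℕ) (cancel : CancelsOrder d D)
    (F : ℕ → List I) (unique : ∀ K → Unique (F K))
    (approximates : ∀ K → Agree K (listSum (map f (F K)) * D) T)
    (remainder : ∀ K i → i ∈ F K ⊎ Order≥ m K (f i * D))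
    where

    -- The shift by `d` pays for the order lost in cancelling `D`.
    truncation : ℕ → Carrier
    truncation N = listSum (map f (F (d ℕ.+ N)))

    -- The limit, read off coefficientwise: agreement to order `N` controls the degrees below `N`,
    -- hence the index one above the degree of `a`.
    total : Carrier
    total = fromCoeff λ (a : Vec ℕ m) → coeff a (truncation (suc (Vec.sum a)))

    agree-cancel : ∀ N p q → Agree (d ℕ.+ N) (p * D) (q * D) → Agree N p q
    agree-cancel N p q pDqD = cancel N (p - q)
      (order-resp (d ℕ.+ N) (p * D - q * D) ((p - q) * D) (sym ([y-z]x≈yx-zx D p q)) pDqD)

    coeff-agree : ∀ {N p q} → Agree N p q → ∀ (a : Vec ℕ m) → Vec.sum a < N → coeff a p R.≈ coeff a q
    coeff-agree {N} {p} {q} pq a a<N = R.a-b≈0⇒a≈b (R.trans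
      (R.sym (R.trans (coeff-+ a p (- q)) (R.+-congˡ (coeff-neg a q)))) (pq a a<N))

    -- After multiplication by `D` both truncations agree with `T` to order `d + M`.
    truncation-agree : ∀ {M N} → M ≤ N → Agree M (truncation M) (truncation N)
    truncation-agree {M} {N} M≤N = agree-cancel M (truncation M) (truncation N)
      (agree-trans (d ℕ.+ M) (truncation M * D) T (truncation N * D) (approximates (d ℕ.+ M))
        (agree-sym (d ℕ.+ M) (truncation N * D) T
          (order-weaken (truncation N * D - T) (ℕ.+-monoʳ-≤ d M≤N) (approximates (d ℕ.+ N)))))

    coeff-total : ∀ (a : Vec ℕ m) → coeff a total ≡ coeff a (truncation (suc (Vec.sum a)))
    coeff-total = coeff-fromCoeff _

    total-agree : ∀ N → Agree N total (truncation N)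
    total-agree N a a<N = R.trans (coeff-+ a total (- truncation N)) (R.trans
      (R.+-cong
        (R.trans (R.reflexive (coeff-total a)) (coeff-agree (truncation-agree a<N) a ℕ.≤-refl))
        (coeff-neg a (truncation N)))
      (R.-‿inverseʳ _))

    total*D≈T : total * D ≈ T
    total*D≈T = a-b≈0⇒a≈b (order-∞ (total * D - T) λ N →
      agree-trans N (total * D) (truncation N * D) T
        (agree-*ʳ N total (truncation N) D (total-agree N))
        (order-weaken (truncation N * D - T) (ℕ.m≤n+m N d) (approximates (d ℕ.+ N))))

    hasSum : HasSum m f total
    -- Outside `F K` the product `f i * D` has order at least `d + N`, so `f i` has order at least
    -- `N` and cannot contribute at `a`.
    hasSum a = F K , λ G uG F⊆G → R.trans
      (coeff-agree (agree-superset N f (F K) G (unique K) uG F⊆G rest) a ℕ.≤-refl)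
      (R.reflexive (≡.sym (coeff-total a)))
      where
      N K : ℕ
      N = suc (Vec.sum a)
      K = d ℕ.+ N
      rest : ∀ {G i} → i ∈ G → i ∈ F K ⊎ Order≥ m N (f i)
      rest {i = i} _ with remainder K i
      ... | inj₁ i∈F = inj₁ i∈F
      ... | inj₂ o   = inj₂ (cancel N (f i) o)

-- The order lost in dividing by differences of variables.

module VariableDifferences {c ℓ} (R : CommutativeRing c ℓ) where

  open MultivariateSeries R
  private
    module S (m : ℕ) = RingTheory (R ⟦ m ⟧)
    module O (m : ℕ) = Orders R m
    module R = RingTheory R

  -- A converse of `order-at`. The restriction `k ≤ N` lets `(d + N) ∸ k` be rewritten as
  -- `d + (N ∸ k)` where this is applied.
  order-coordinates : ∀ m N (q : S.Carrier (suc m)) →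
    (∀ k → k ≤ N → Order≥ m (N ∸ k) (q k)) → Order≥ (suc m) N q
  order-coordinates m N q oq (k ∷ b) k+b<N =
    oq k (ℕ.≤-trans (ℕ.m≤m+n k _) (ℕ.<⇒≤ k+b<N)) b
      (ℕ.m+n≤o⇒m≤o∸n _ (ℕ.≤-trans (ℕ.≤-reflexive (≡.cong suc (ℕ.+-comm (Vec.sum b) k))) k+b<N))

  module _ (m : ℕ) where

    open PowerSeries (R ⟦ m ⟧) using (constant; X; ⊛-comm; constant-⊛; X-⊛-zero; X-⊛-suc)
    open S m
    open O m
    open SetoidReasoning setoid
    private
      module P = S (suc m)
      module P′ = O (suc m)

    cancels-constant : ∀ d g → CancelsOrder d g → P′.CancelsOrder d (constant g)
    cancels-constant d g cg N q o = order-coordinates m N q λ k k≤N → cg (N ∸ k) (q k)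
      (order-resp (d ℕ.+ (N ∸ k)) ((q P.* constant g) k) (q k * g)
        (trans (⊛-comm q (constant g) k) (trans (constant-⊛ g q k) (*-comm _ _)))
        (≡.subst (λ M → Order≥ m M ((q P.* constant g) k)) (ℕ.+-∸-assoc d k≤N)
          (order-at m (d ℕ.+ N) (q P.* constant g) k o)))

    cancels-X : P′.CancelsOrder 1 X
    cancels-X N q o (k ∷ b) k+b<N = R.trans
      (coeff-cong b (sym (trans (⊛-comm q X (suc k)) (X-⊛-suc q k))))
      (o (suc k ∷ b) (s≤s k+b<N))

    -- With `r = q (X - a)`, comparing coefficients gives `a * q k` as `q (k - 1)` minus `r k`. By
    -- induction on `k` both have order at least `suc N ∸ k`, and cancelling `a` costs one.
    cancels-X-constant : ∀ a → CancelsOrder 1 a → P′.CancelsOrder 1 (X P.- constant a)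
    cancels-X-constant a ca N q o = order-coordinates m N q vanish
      where
      expand : ∀ k → a * q k ≈ (X P.* q) k - (q P.* (X P.- constant a)) k
      expand k = begin
        a * q k
          ≈⟨ constant-⊛ a q k ⟨
        ca′
          ≈⟨ -‿involutive ca′ ⟨
        - - ca′
          ≈⟨ +-identityˡ _ ⟨
        0# - - ca′
          ≈⟨ +-congʳ (-‿inverseʳ Xq) ⟨
        (Xq - Xq) - - ca′
          ≈⟨ +-assoc _ _ _ ⟩
        Xq + (- Xq - - ca′)
          ≈⟨ +-congˡ (-‿+-comm Xq (- ca′)) ⟩
        Xq - (Xq - ca′)
          ≈⟨ +-congˡ (-‿cong (P.[y-z]x≈yx-zx q X (constant a) k)) ⟨
        Xq - ((X P.- constant a) P.* q) k
          ≈⟨ +-congˡ (-‿cong (⊛-comm (X P.- constant a) q k)) ⟩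
        Xq - (q P.* (X P.- constant a)) k ∎
        where
        ca′ Xq : Carrier
        ca′ = (constant a P.* q) k
        Xq  = (X P.* q) k
      step : ∀ k → k ≤ N → Order≥ m (suc N ∸ k) ((X P.* q) k) → Order≥ m (N ∸ k) (q k)
      step k k≤N oX = ca (N ∸ k) (q k) (≡.subst (λ M → Order≥ m M (q k * a)) (ℕ.+-∸-assoc 1 k≤N)
        (order-resp (suc N ∸ k) ((X P.* q) k - (q P.* (X P.- constant a)) k) (q k * a)
          (trans (sym (expand k)) (*-comm _ _))
          (order-+ m (suc N ∸ k) ((X P.* q) k) (- (q P.* (X P.- constant a)) k) oX
            (order-neg m (suc N ∸ k) ((q P.* (X P.- constant a)) k)
              (order-at m (suc N) (q P.* (X P.- constant a)) k o)))))
      vanish : ∀ k → k ≤ N → Order≥ m (N ∸ k) (q k)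
      vanish zero    _   = step zero z≤n
        (order-resp (suc N) 0# ((X P.* q) 0) (sym (X-⊛-zero q)) (order-0 (suc N)))
      vanish (suc k) k<N = step (suc k) k<N
        (order-resp (N ∸ k) (q k) ((X P.* q) (suc k)) (sym (X-⊛-suc q k)) (vanish k (ℕ.<⇒≤ k<N)))

  cancels-var : ∀ {m} (i : Fin m) → O.CancelsOrder m 1 (var i)
  cancels-var {suc m} zero    = cancels-X m
  cancels-var {suc m} (suc i) = cancels-constant m 1 (var i) (cancels-var i)

  cancels-var-var : ∀ {m} (i j : Fin m) → i ≢ j → O.CancelsOrder m 1 (S._-_ m (var i) (var j))
  cancels-var-var {suc m} zero    zero    i≢j = ⊥-elim (i≢j ≡.refl)
  cancels-var-var {suc m} zero    (suc j) i≢j = cancels-X-constant m (var j) (cancels-var j)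
  -- The negative of a difference of the form `X - a`.
  cancels-var-var {suc m} (suc i) zero    i≢j =
    O.cancels-resp (suc m) 1 (P.- (var {suc m} zero P.- var (suc i))) (var (suc i) P.- var {suc m} zero)
      (P.trans (P.sym (P.-‿+-comm _ _)) (P.trans (P.+-congˡ (P.-‿involutive _)) (P.+-comm _ _)))
      (O.cancels-neg (suc m) 1 (var {suc m} zero P.- var (suc i)) (cancels-X-constant m (var i) (cancels-var i)))
    where module P = S (suc m)
  cancels-var-var {suc m} (suc i) (suc j) i≢j =
    O.cancels-resp (suc m) 1 _ (S._-_ (suc m) (var (suc i)) (var (suc j)))
      (constant-minus m (var i) (var j))
      (cancels-constant m 1 (S._-_ m (var i) (var j)) (cancels-var-var i j (i≢j ∘ ≡.cong suc)))

  cancels-Δ : ∀ {n} m (ι : Fin n → Fin m) → (∀ {i j} → ι i ≡ ι j → i ≡ j) →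
              ∃[ d ] O.CancelsOrder m d (S.Δ m (var ∘ ι))
  cancels-Δ {n} m ι ι-injective = O.cancels-∏ m n _ λ i → O.cancels-∏ m n _ λ j → factor i j
    where
    open S m
    factor : ∀ i j → ∃[ d ] O.CancelsOrder m d (if does (i <? j) then var (ι i) - var (ι j) else 1#)
    factor i j with toℕ i ℕ.<ᵇ toℕ j in i<ᵇj
    ... | true  = 1 , cancels-var-var (ι i) (ι j) λ eq →
                    <⇒≢ (ℕ.<ᵇ⇒< (toℕ i) (toℕ j) (≡.subst Bool.T (≡.sym i<ᵇj) tt)) (ι-injective eq)
    ... | false = 0 , O.cancels-1 m

-- Truncated determinant entries and the resulting identity.

module CauchyIdentity {c ℓ} (R : CommutativeRing c ℓ) (m : ℕ) where

  open MultivariateSeries R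
  open RingTheory (R ⟦ m ⟧)
  open Determinants (R ⟦ m ⟧)
  open Orders R m
  open SetoidReasoning setoid
  open SemiringSolver commutativeSemiring using (solve; _:=_; _:+_; _:*_; con)

  geo : Carrier → Carrier
  geo = geometric m

  below-telescope : ∀ u K → (1# - u) * below (u ^_) K ≈ 1# - u ^ K
  below-telescope u zero    = trans (zeroʳ _) (sym (-‿inverseʳ 1#))
  below-telescope u (suc K) = begin
    (1# - u) * (below (u ^_) K + u ^ K)              ≈⟨ distribˡ _ _ _ ⟩
    (1# - u) * below (u ^_) K + (1# - u) * u ^ K     ≈⟨ +-cong (below-telescope u K) ([y-z]x≈yx-zx _ 1# u) ⟩
    (1# - u ^ K) + (1# * u ^ K - u * u ^ K)          ≈⟨ +-congˡ (+-congʳ (*-identityˡ _)) ⟩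
    (1# - u ^ K) + (u ^ K - u * u ^ K)               ≈⟨ +-assoc _ _ _ ⟨
    ((1# - u ^ K) + u ^ K) - u * u ^ K               ≈⟨ +-congʳ (a-b+b≈a 1# (u ^ K)) ⟩
    1# - u ^ suc K                                   ∎

  -- Since `geo u` inverts `1# - u`, telescoping gives `geo u - s ≈ geo u * u ^ K`, which has order
  -- at least `K`.
  geometric-agree : ∀ K u → Order≥ m 1 u → Agree K (below (u ^_) K) (geo u)
  geometric-agree K u ou = agree-sym K (geo u) s
    (order-resp K (geo u * p) (geo u - s) (begin
      geo u * p                 ≈⟨ a+b-b≈a _ s ⟨
      (geo u * p + s) - s       ≈⟨ +-congʳ split ⟨
      geo u - s                 ∎)
      (order-*ʳ K (geo u) p (order-^ m u ou K)))
    where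
    s p : Carrier
    s = below (u ^_) K
    p = u ^ K
    split : geo u ≈ geo u * p + s
    split = begin
      geo u                              ≈⟨ *-identityʳ _ ⟨
      geo u * 1#                         ≈⟨ *-congˡ (a-b+b≈a 1# p) ⟨
      geo u * ((1# - p) + p)             ≈⟨ distribˡ _ _ _ ⟩
      geo u * (1# - p) + geo u * p       ≈⟨ +-congʳ (*-congˡ (below-telescope u K)) ⟨
      geo u * ((1# - u) * s) + geo u * p
        ≈⟨ solve 4 (λ g v s p → g :* (v :* s) :+ g :* p := g :* p :+ v :* g :* s) refl
             (geo u) (1# - u) s p ⟩
      geo u * p + (1# - u) * geo u * s   ≈⟨ +-congˡ (*-congʳ (geometric-inverse m u ou)) ⟩
      geo u * p + 1# * s                 ≈⟨ +-congˡ (*-identityˡ s) ⟩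
      geo u * p + s                      ∎

  module _ (t : Carrier) where

    weight : ℕ → Carrier
    weight k = 1# - t ^ suc k

    -- Over the common denominator the numerator is `(1 - t u) - t (1 - u)`, which is `1 - t`.
    partialFractions : ∀ u → Order≥ m 1 u → geo u - t * geo (t * u) ≈ (1# - t) * geo u * geo (t * u)
    partialFractions u ou = begin
      g - t * h
        -- Each fraction is extended by the denominator of the other times its inverse.
        ≈⟨ +-cong (trans (sym (*-identityʳ g)) (*-congˡ (sym (geometric-inverse m (t * u) (order-*ʳ 1 t u ou)))))
                  (-‿cong (*-congˡ (trans (sym (*-identityˡ h)) (*-congʳ (sym (geometric-inverse m u ou)))))) ⟩
      g * ((1# - t * u) * h) - t * ((1# - u) * g * h)
        ≈⟨ +-cong (solve 3 (λ g v h → g :* (v :* h) := v :* (g :* h)) refl g (1# - t * u) h)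
                  (-‿cong (solve 4 (λ t v g h → t :* (v :* g :* h) := t :* v :* (g :* h)) refl t (1# - u) g h)) ⟩
      (1# - t * u) * (g * h) - t * (1# - u) * (g * h)
        ≈⟨ [y-z]x≈yx-zx (g * h) _ _ ⟨
      ((1# - t * u) - t * (1# - u)) * (g * h)
        ≈⟨ *-congʳ numerator ⟩
      (1# - t) * (g * h)
        ≈⟨ *-assoc _ _ _ ⟨
      (1# - t) * g * h ∎
      where
      g h : Carrier
      g = geo u
      h = geo (t * u)
      numerator : (1# - t * u) - t * (1# - u) ≈ 1# - t
      numerator = begin
        (1# - t * u) - t * (1# - u)
          ≈⟨ +-congˡ (trans (-‿distribʳ-* t (1# - u)) (*-congˡ (trans (sym (-‿+-comm 1# (- u))) (+-congˡ (-‿involutive u))))) ⟩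
        (1# - t * u) + t * (- 1# + u)
          ≈⟨ solve 4 (λ w t v u → (con 1 :+ w) :+ t :* (v :+ u) := (con 1 :+ t :* v) :+ (t :* u :+ w))
               refl (- (t * u)) t (- 1#) u ⟩
        (1# + t * - 1#) + (t * u - t * u)
          ≈⟨ +-cong (+-congˡ (trans (sym (-‿distribʳ-* t 1#)) (-‿cong (*-identityʳ t)))) (-‿inverseʳ _) ⟩
        (1# - t) + 0#
          ≈⟨ +-identityʳ _ ⟩
        1# - t ∎

    -- Termwise, `t ^ suc k * (a b) ^ k` is `t * (t a b) ^ k`, so the weight splits the sum into two
    -- geometric ones.
    below-weighted : ∀ a b K →
      below (λ k → weight k * (a ^ k * b ^ k)) K ≈ below ((a * b) ^_) K - t * below ((t * (a * b)) ^_) K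
    below-weighted a b zero    = sym (trans (+-congˡ (-‿cong (zeroʳ t))) (-‿inverseʳ 0#))
    below-weighted a b (suc K) = begin
      below (λ k → weight k * (a ^ k * b ^ k)) K + weight K * (a ^ K * b ^ K)
        ≈⟨ +-cong (below-weighted a b K) power ⟩
      (p - t * q) + (p′ - t * q′)
        ≈⟨ solve 4 (λ a b c d → (a :+ b) :+ (c :+ d) := (a :+ c) :+ (b :+ d)) refl p (- (t * q)) p′ (- (t * q′)) ⟩
      (p + p′) + (- (t * q) - t * q′)
        ≈⟨ +-congˡ (trans (-‿+-comm _ _) (-‿cong (sym (distribˡ t q q′)))) ⟩
      (p + p′) - t * (q + q′) ∎
      where
      open CommutativeExp commutativeSemiring using (^-distrib-*)
      p q p′ q′ : Carrier
      p  = below ((a * b) ^_) K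
      q  = below ((t * (a * b)) ^_) K
      p′ = (a * b) ^ K
      q′ = (t * (a * b)) ^ K
      power : weight K * (a ^ K * b ^ K) ≈ p′ - t * q′
      power = begin
        weight K * (a ^ K * b ^ K)     ≈⟨ *-congˡ (^-distrib-* a b K) ⟨
        weight K * p′                  ≈⟨ [y-z]x≈yx-zx p′ 1# (t ^ suc K) ⟩
        1# * p′ - t * t ^ K * p′       ≈⟨ +-cong (*-identityˡ p′) (-‿cong (*-assoc t (t ^ K) p′)) ⟩
        p′ - t * (t ^ K * p′)          ≈⟨ +-congˡ (-‿cong (*-congˡ (^-distrib-* t (a * b) K))) ⟨
        p′ - t * q′                    ∎

    entry-agree : ∀ a b → Order≥ m 1 (a * b) → ∀ K →
      Agree K (below (λ k → weight k * (a ^ k * b ^ k)) K)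
              ((1# - t) * geo (a * b) * geo (t * (a * b)))
    entry-agree a b oab K =
      agree-trans K (below (λ k → weight k * (a ^ k * b ^ k)) K) (p - t * q) entry
        (agree-reflexive K (below (λ k → weight k * (a ^ k * b ^ k)) K) (p - t * q) (below-weighted a b K))
      (agree-trans K (p - t * q) (g - t * h) entry
        (agree-+ K p g (- (t * q)) (- (t * h)) (geometric-agree K u oab)
          (agree-neg K (t * q) (t * h) (agree-* K t t q h (agree-reflexive K t t refl)
            (geometric-agree K (t * u) (order-*ʳ 1 t u oab)))))
        (agree-reflexive K (g - t * h) entry (partialFractions u oab)))
      where
      u p q g h entry : Carrier
      u = a * b
      p = below (u ^_) K
      q = below ((t * u) ^_) K
      g = geo u
      h = geo (t * u)
      entry = (1# - t) * g * h

    module _ {n : ℕ} (x y : Fin n → Carrier)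
      (regular-x : Regular (Δ x)) (regular-y : Regular (Δ y))
      (order-x : ∀ i → Order≥ m 1 (x i))
      (cancels-x : ∃[ d ] CancelsOrder d (Δ x)) (cancels-y : ∃[ d ] CancelsOrder d (Δ y))
      where

      sˣ sʸ : Partition n → Carrier
      sˣ μ = Quotient.value (schur x regular-x μ)
      sʸ μ = Quotient.value (schur y regular-y μ)

      term : Partition n → Carrier
      term μ = (∏[ i < n ] (1# - t ^ suc (exponent μ i))) * sˣ μ * sʸ μ

      D : Carrier
      D = Δ x * Δ y

      entry : Fin n → Fin n → Carrier
      entry i j = (1# - t) * geo (x i * y j) * geo (t * (x i * y j))

      -- `Δ x` and `Δ y` turn the Schur quotients back into alternants, which are the minors in
      -- Cauchy-Binet.
      term*D : ∀ μ → term μ * D ≈ cauchyBinetTerm weight (λ k i → x i ^ k) (λ k j → y j ^ k) μ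
      term*D μ = trans
        (solve 5 (λ c p q v w → c :* p :* q :* (v :* w) := c :* ((p :* v) :* (q :* w))) refl
          (∏[ i < n ] (1# - t ^ suc (exponent μ i))) (sˣ μ) (sʸ μ) (Δ x) (Δ y))
        (*-congˡ (*-cong (Quotient.exact (schur x regular-x μ)) (Quotient.exact (schur y regular-y μ))))

      approximates : ∀ K → Agree K (listSum (map term (boundedPartitions n K)) * D) (det entry)
      approximates K = agree-trans K (listSum (map term (boundedPartitions n K)) * D) (det truncated) (det entry)
        (agree-reflexive K (listSum (map term (boundedPartitions n K)) * D) (det truncated) (begin
          listSum (map term (boundedPartitions n K)) * D
            ≈⟨ *-distribʳ-listSum D term (boundedPartitions n K) ⟩
          listSum (map (λ μ → term μ * D) (boundedPartitions n K))
            ≈⟨ listSum-map-cong term*D (boundedPartitions n K) ⟩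
          listSum (map (cauchyBinetTerm weight (λ k i → x i ^ k) (λ k j → y j ^ k)) (boundedPartitions n K))
            ≈⟨ cauchyBinet K weight (λ k i → x i ^ k) (λ k j → y j ^ k) ⟨
          det truncated ∎))
        (agree-det K n truncated entry λ i j →
          entry-agree (x i) (y j) (order-*ˡ 1 (x i) (y j) (order-x i)) K)
        where
        truncated : Fin n → Fin n → Carrier
        truncated i j = below (λ k → weight k * (x i ^ k * y j ^ k)) K

      -- An exponent not below `K` makes a whole column of the alternant in `x` have order at least
      -- `K`.
      remainder : ∀ K μ → μ ∈ boundedPartitions n K ⊎ Order≥ m K (term μ * D)
      remainder K μ with all? (λ j → exponent μ j ℕ.<? K)
      ... | yes bound = inj₁ (∈-boundedPartitions K μ bound)
      ... | no  ¬bound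
        with j , e≮K ← ¬∀⟶∃¬ n (λ j → exponent μ j < K) (λ j → exponent μ j ℕ.<? K) ¬bound
        = inj₂ (order-resp K (C * (αˣ * αʸ)) (term μ * D) (sym (term*D μ))
            (order-*ʳ K C (αˣ * αʸ) (order-*ˡ K αˣ αʸ
              (order-det-column K n (λ i j → x i ^ exponent μ j) j λ i →
                order-weaken (x i ^ exponent μ j) (ℕ.≮⇒≥ e≮K)
                  (order-^ m (x i) (order-x i) (exponent μ j))))))
        where
        C αˣ αʸ : Carrier
        C = ∏[ i < n ] weight (exponent μ i)
        αˣ = det (λ i j → x i ^ exponent μ j)
        αʸ = det (λ i j → y i ^ exponent μ j)

      open Summation term D (det entry) _
             (cancels-* (proj₁ cancels-x) (proj₁ cancels-y) (Δ x) (Δ y) (proj₂ cancels-x) (proj₂ cancels-y))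
             (boundedPartitions n) (boundedPartitions-unique n) approximates remainder

      identity : Σ[ rhs ∈ Quotient (det entry) D ] HasSum m term (Quotient.value rhs)
      -- The sum itself serves as the fraction: `total*D≈T` makes it exact and regularity makes it
      -- unique.
      identity = quotient (regular-* regular-x regular-y) (total , total*D≈T) , hasSum

theorem1 : (n : ℕ) → .{{_ : NonZero n}} →
    let open Variables n in
    Σ[ rhs ∈ Quotient (det (λ i j → (1# - t) * geometric (x i * y j) * geometric (t * (x i * y j))))
                      (Δ x * Δ y) ]
      HasSum (λ μ → (∏[ i < n ] (1# - t ^ suc (exponent μ i))) * schurˣ μ * schurʸ μ)
             (Quotient.value rhs)
theorem1 n = CauchyIdentity.identity ℤ[t] (n ℕ.+ n) t x y
  -- The regularity proofs are those inside `schurˣ` and `schurʸ`, so the summands match by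
  -- computation.
  (Δ-regular (n ℕ.+ n) (_↑ˡ n) (↑ˡ-injective n _ _))
  (Δ-regular (n ℕ.+ n) (n ↑ʳ_) (↑ʳ-injective n _ _))
  (λ i → order-var (i ↑ˡ n))
  (cancels-Δ (n ℕ.+ n) (_↑ˡ n) (↑ˡ-injective n _ _))
  (cancels-Δ (n ℕ.+ n) (n ↑ʳ_) (↑ʳ-injective n _ _))
  where
  open Variables n
  open MultivariateSeries ℤ[t] using (Δ-regular; order-var)
  open VariableDifferences ℤ[t] using (cancels-Δ)
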